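{- Let $\mathcal P$ be a finite chiral polytope, and suppose that \[ \left( \frac{|\Gamma^+(\mathcal P) \diamond \Gamma^+(\overline{\mathcal P})|}{|\Gamma^+(\mathcal P)|} \right)^2 > \left| \left(\Gamma^+(\mathcal P) \diamond \Gamma^+(\overline{\mathcal P})\right) \mathbin{\square} \left(\Gamma^+(\mathcal P^{\delta}) \diamond \Gamma^+(\overline{\mathcal P}^{\delta})\right) \right|. \] Then $\mathcal P \diamond \mathcal P^{\delta}$ is chiral.
   Context: An abstract polytope of rank $n$ (an $n$-polytope) is a ranked poset of faces with ranks from $-1$ to $n$, with a unique least face (rank $-1$) and a unique greatest face (rank $n$), in which every flag (maximal chain) has $n+2$ faces, which satisfies the diamond condition (whenever $F<G$ with ranks $j-1$ and $j+1$ there are exactly two $j$-faces strictly between them), and which is strongly flag-connected (any two flags $\Phi,\Psi$ are joined by a sequence of flags, consecutive ones adjacent, all containing $\Phi\cap\Psi$; two flags are adjacent if they differ in exactly one face). $\Phi^j$ denotes the unique flag differing from $\Phi$ only in its $j$-face, and $\Phi^{i,j}=(\Phi^i)^j$. Each polytope considered has a fixed base flag $\Phi$. $\mathcal P$ is chiral if its automorphism group $\Gamma(\mathcal P)$ has exactly two orbits on flags and adjacent flags lie in distinct orbits; then $\Gamma^+(\mathcal P):=\Gamma(\mathcal P)$ is generated by $\sigma_1,\dots,\sigma_{n-1}$, where $\sigma_i$ maps $\Phi$ to $\Phi^{i,i-1}$. One has $(\sigma_i\cdots\sigma_j)^2=1$ for $i<j$. Let $W^+=\langle \sigma_1,\dots,\sigma_{n-1}\mid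 (\sigma_i\cdots\sigma_j)^2=1 \text{ for } 1\le i<j\le n-1\rangle$. Writing $\Gamma^+(\mathcal P)=W^+/M$ means that $M$ is the kernel of the epimorphism $W^+\to\Gamma^+(\mathcal P)$ preserving the specified generators. For $w\in W^+$, $\overline w$ is obtained by replacing $\sigma_1$ by $\sigma_1^{ -1}$, $\sigma_2$ by $\sigma_1^2\sigma_2$ and fixing $\sigma_j$ for $j\ge3$; $\delta(w)$ is obtained by replacing each $\sigma_i$ by $\sigma_{n-i}^{ -1}$ (both are automorphisms of $W^+$). Put $\overline M=\{\overline w:w\in M\}$, $\delta(M)=\{\delta(w):w\in M\}$; one has $\delta(\overline M)=\overline{\delta(M)}$. If $\Gamma^+(\mathcal P)=W^+/M$ with $\mathcal P$ chiral, then $\overline M\ne M$; the mirror image $\overline{\mathcal P}$ (same faces, base flag $\Phi^0$) has $\Gamma^+(\overline{\mathcal P})=W^+/\overline M$, the dual $\mathcal P^\delta$ (reversed order) has $\Gamma^+(\mathcal P^\delta)=W^+/\delta(M)$, and $\Gamma^+(\overline{\mathcal P}^\delta)=W^+/\delta(\overline M)$. Mix and comix: for groups with specified generators $\Gamma=\langle x_1,\dots,x_k\mid R\rangle$, $\Gamma'=\langle x_1',\dots,x_k'\mid S\rangle$, the mix $\Gamma\diamond\Gamma'$ is the subgroup of $\Gamma\times\Gamma'$ with specified generators $(x_i,x_i')$, $i=1,\dots,k$, and the comix $\Gamma\mathbin{\square}\Gamma'$ is the group $\langle x_1,x_1',\dots,x_k,x_k'\mid R,S,x_1^{ -1}x_1',\dots,x_k^{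 -1}x_k'\rangle$. $\mathcal P\diamond\mathcal Q$ is the flag-connected pre-polytope (polytope axioms with strong flag-connectedness weakened to flag-connectedness) built from $\Gamma^+(\mathcal P)\diamond\Gamma^+(\mathcal Q)$; it is handled through $\Gamma^+(\mathcal P\diamond\mathcal Q)=\Gamma^+(\mathcal P)\diamond\Gamma^+(\mathcal Q)=W^+/N$, and it is directly regular if $\overline N=N$ and chiral if $\overline N\ne N$ (it need not be polytopal). -}

module Defs where

open import Algebra.Bundles using (Group)
import Algebra.Construct.DirectProduct as DirectProduct
open import Data.Bool.Base using (Bool; T; if_then_else_)
open import Data.Bool.Properties using (T-irrelevant)
open import Data.Empty using (⊥-elim)
open import Data.Fin.Base as Fin using (Fin; zero; suc; toℕ; fromℕ; inject₁; opposite; punchOut)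
open import Data.Fin.Properties as Finₚ using (toℕ-injective; toℕ-inject₁; opposite-prop; opposite-involutive)
open import Data.List.Base using (foldr; filter; allFin)
open import Data.Nat.Base as ℕ using (ℕ; zero; suc; _∸_)
import Data.Nat.Properties as ℕₚ
open import Data.Product.Base using (Σ; ∃; ∃₂; _×_; _,_; proj₁; proj₂)
open import Data.Sum.Base using (_⊎_; inj₁; inj₂; [_,_]′; swap)
open import Function.Base using (_∘_; id; flip)
open import Function.Bundles using (Inverse; _↔_)
open import Function.Definitions using (Injective)
open import Level using (0ℓ)
open import Relation.Binary.Construct.Closure.ReflexiveTransitive as Star using (Star; _◅_; gmap)
import Relation.Binary.Construct.Flip.EqAndOrd as Flip
open import Relation.Binary.Core using (Rel)
open import Relation.Binary.Definitions using (tri<; tri≈; tri>)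
import Relation.Binary.Morphism.Construct.Composition as ComposeMorphism
import Relation.Binary.Morphism.Construct.Identity as IdentityMorphism
open import Relation.Binary.Morphism.Structures using (IsOrderIsomorphism)
open import Relation.Binary.PropositionalEquality using (_≡_; _≢_; _≗_; refl; sym; trans; cong; subst; setoid)
open import Relation.Binary.Structures using (IsDecPartialOrder)
open import Relation.Nullary using (¬_; Dec; yes; no; contradiction)
open import Relation.Nullary.Decidable using (⌊_⌋; _×-dec_)
open import Relation.Unary using (Pred; _≐_)

infixl 7 _·_
infix  4 _⊢_≈_

data Term (X : Set) : Set where
  var : X → Term X
  𝟙   : Term X
  _·_ : Term X → Term X → Term X
  inv : Term X → Term X

_>>=_ : ∀ {X Y : Set} → Term X → (X → Term Y) → Term Y
var x   >>= f = f x
𝟙       >>= f = 𝟙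
(s · t) >>= f = (s >>= f) · (t >>= f)
inv t   >>= f = inv (t >>= f)

-- The least congruence that contains the group laws and kills R.
data _⊢_≈_ {X : Set} (R : Pred (Term X) 0ℓ) : Rel (Term X) 0ℓ where
  ≈-rel      : ∀ {t} → R t → R ⊢ t ≈ 𝟙
  ≈-refl     : ∀ {t} → R ⊢ t ≈ t
  ≈-sym      : ∀ {s t} → R ⊢ s ≈ t → R ⊢ t ≈ s
  ≈-trans    : ∀ {s t u} → R ⊢ s ≈ t → R ⊢ t ≈ u → R ⊢ s ≈ u
  ·-cong     : ∀ {s s′ t t′} → R ⊢ s ≈ s′ → R ⊢ t ≈ t′ → R ⊢ s · t ≈ (s′ · t′)
  inv-cong   : ∀ {s t} → R ⊢ s ≈ t → R ⊢ inv s ≈ inv t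
  ·-assoc    : ∀ s t u → R ⊢ (s · t) · u ≈ (s · (t · u))
  ·-identityˡ : ∀ t → R ⊢ 𝟙 · t ≈ t
  ·-identityʳ : ∀ t → R ⊢ t · 𝟙 ≈ t
  ·-inverseˡ  : ∀ t → R ⊢ inv t · t ≈ 𝟙
  ·-inverseʳ  : ∀ t → R ⊢ t · inv t ≈ 𝟙

⟨_∣_⟩ : (X : Set) → Pred (Term X) 0ℓ → Group 0ℓ 0ℓ
⟨ X ∣ R ⟩ = record
  { Carrier = Term X
  ; _≈_     = R ⊢_≈_
  ; _∙_     = _·_
  ; ε       = 𝟙
  ; _⁻¹     = inv
  ; isGroup = record
    { isMonoid = record
      { isSemigroup = record
        { isMagma = record
          { isEquivalence = record { refl = ≈-refl ; sym = ≈-sym ; trans = ≈-trans }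
          ; ∙-cong        = ·-cong
          }
        ; assoc = ·-assoc
        }
      ; identity = ·-identityˡ , ·-identityʳ
      }
    ; inverse = ·-inverseˡ , ·-inverseʳ
    ; ⁻¹-cong = inv-cong
    }
  }

-- That the specified elements generate is not part of the record: it holds
-- by construction for a mix, and is a theorem for the group of a chiral polytope.
record MarkedGroup (k : ℕ) : Set₁ where
  field
    group : Group 0ℓ 0ℓ
    gen   : Fin k → Group.Carrier group

  open Group group public

  eval : Term (Fin k) → Carrier
  eval (var i) = gen i
  eval 𝟙       = ε
  eval (s · t) = eval s ∙ eval t
  eval (inv t) = eval t ⁻¹

  Relator : Pred (Term (Fin k)) 0ℓ
  Relator t = eval t ≈ ε

⟪_⟫ : ∀ {k} → MarkedGroup k → MarkedGroup k
⟪_⟫ {k} G = record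
  { group = record
    { Carrier = Σ Carrier λ g → ∃ λ t → eval t ≈ g
    ; _≈_     = λ g h → proj₁ g ≈ proj₁ h
    ; _∙_     = λ { (g , s , p) (h , t , q) → g ∙ h , s · t , ∙-cong p q }
    ; ε       = ε , 𝟙 , Group.refl group
    ; _⁻¹     = λ { (g , s , p) → g ⁻¹ , inv s , ⁻¹-cong p }
    ; isGroup = record
      { isMonoid = record
        { isSemigroup = record
          { isMagma = record
            { isEquivalence = record
              { refl  = Group.refl group
              ; sym   = Group.sym group
              ; trans = Group.trans group
              }
            ; ∙-cong = ∙-cong
            }
          ; assoc = λ x y z → assoc (proj₁ x) (proj₁ y) (proj₁ z)
          }
        ; identity = (λ x → identityˡ (proj₁ x)) , (λ x → identityʳ (proj₁ x))
        }
      ; inverse = (λ x → inverseˡ (proj₁ x)) , (λ x → inverseʳ (proj₁ x))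
      ; ⁻¹-cong = ⁻¹-cong
      }
    }
  ; gen = λ i → gen i , var i , Group.refl group
  }
  where open MarkedGroup G

infixr 7 _◇_
infix  6 _□_

_◇_ : ∀ {k} → MarkedGroup k → MarkedGroup k → MarkedGroup k
G ◇ H = ⟪ record
  { group = DirectProduct.group G.group H.group
  ; gen   = λ i → G.gen i , H.gen i
  } ⟫
  where
  module G = MarkedGroup G
  module H = MarkedGroup H

-- The comix does not depend on the presentations chosen for the two factors;
-- each factor is presented by all relators that hold among its generators.
data ComixRelator {k} (G H : MarkedGroup k) : Pred (Term (Fin k ⊎ Fin k)) 0ℓ where
  left  : ∀ t → MarkedGroup.Relator G t → ComixRelator G H (t >>= (var ∘ inj₁))
  right : ∀ t → MarkedGroup.Relator H t → ComixRelator G H (t >>= (var ∘ inj₂))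
  glue  : ∀ i → ComixRelator G H (inv (var (inj₁ i)) · var (inj₂ i))

_□_ : ∀ {k} → MarkedGroup k → MarkedGroup k → Group 0ℓ 0ℓ
_□_ {k} G H = ⟨ Fin k ⊎ Fin k ∣ ComixRelator G H ⟩

HasOrder : Group 0ℓ 0ℓ → ℕ → Set
HasOrder G m = Inverse (Group.setoid G) (setoid (Fin m))

-- Sets of faces are Boolean-valued: for arbitrary predicates, requiring every
-- maximal chain to have n + 2 elements would imply weak excluded middle as soon
-- as there are two vertices.
module _ {Face : Set} where

  infix 4 _∈_ _⊆_

  _∈_ : Face → (Face → Bool) → Set
  F ∈ C = T (C F)

  _⊆_ : Rel (Face → Bool) 0ℓ
  C ⊆ D = ∀ {F} → F ∈ C → F ∈ D

module _ {Face : Set} (_≤_ : Rel Face 0ℓ) where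

  IsChain : (Face → Bool) → Set
  IsChain C = ∀ {F G} → F ∈ C → G ∈ C → F ≤ G ⊎ G ≤ F

  record Flag : Set where
    field
      set     : Face → Bool
      chain   : IsChain set
      maximal : ∀ D → IsChain D → set ⊆ D → D ⊆ set

open Flag public

module _ {Face : Set} {_≤_ : Rel Face 0ℓ} where

  -- Equality of flags as sets of faces; _≡_ would need function extensionality.
  _≋_ : Rel (Flag _≤_) 0ℓ
  Φ ≋ Ψ = set Φ ≗ set Ψ

  module _ {r : ℕ} (rank : Face → Fin r) where

    AdjacentAt : Fin r → Rel (Flag _≤_) 0ℓ
    AdjacentAt j Φ Ψ = ¬ (Φ ≋ Ψ) × (∀ F → rank F ≢ j → set Φ F ≡ set Ψ F)

    Adjacent : Rel (Flag _≤_) 0ℓ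
    Adjacent Φ Ψ = ∃ λ j → AdjacentAt j Φ Ψ

    -- Paths of such steps that start at Φ consist of flags containing Φ ∩ Ψ.
    Step : (Φ Ψ : Flag _≤_) → Rel (Flag _≤_) 0ℓ
    Step Φ Ψ Θ Θ′ = Adjacent Θ Θ′ × (∀ {F} → F ∈ set Φ → F ∈ set Ψ → F ∈ set Θ′)

ExactlyTwo : {A : Set} → Pred A 0ℓ → Set
ExactlyTwo P = ∃₂ λ x y → x ≢ y × P x × P y × (∀ z → P z → z ≡ x ⊎ z ≡ y)

-- Ranks -1, 0, …, n are represented by 0, 1, …, n + 1.
record Polytope (n : ℕ) : Set₁ where
  infix 4 _≤_ _<_

  field
    Face              : Set
    _≤_               : Rel Face 0ℓ
    isDecPartialOrder : IsDecPartialOrder _≡_ _≤_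
    rank              : Face → Fin (2 ℕ.+ n)

  _<_ : Rel Face 0ℓ
  F < G = F ≤ G × F ≢ G

  field
    rank-mono      : ∀ {F G} → F < G → rank F Fin.< rank G
    least          : Face
    least-minimum  : ∀ F → least ≤ F
    least-rank     : rank least ≡ zero
    greatest       : Face
    greatest-maximum : ∀ F → F ≤ greatest
    greatest-rank  : rank greatest ≡ fromℕ (suc n)
    flag-size      : ∀ (Φ : Flag _≤_) → (∃ λ F → F ∈ set Φ) ↔ Fin (2 ℕ.+ n)
    diamond        : ∀ {F G} → F < G → toℕ (rank G) ≡ 2 ℕ.+ toℕ (rank F) →
                     ExactlyTwo λ H → toℕ (rank H) ≡ 1 ℕ.+ toℕ (rank F) × F < H × H < G
    strongly-flag-connected :
                     ∀ (Φ Ψ : Flag _≤_) →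
                     ∃ λ Ψ′ → Star (Step rank Φ Ψ) Φ Ψ′ × Ψ′ ≋ Ψ

  open IsDecPartialOrder isDecPartialOrder public
    using (isPartialOrder; _≟_; _≤?_; antisym)
    renaming (refl to ≤-refl; trans to ≤-trans)

Finite : ∀ {n} → Polytope n → Set
Finite P = ∃ λ m → Polytope.Face P ↔ Fin m

injective⇒hits : ∀ {m} (f : Fin m → Fin m) → Injective _≡_ _≡_ f → ∀ j → ∃ λ i → f i ≡ j
injective⇒hits {suc m} f inj j with Finₚ.any? (λ i → f i Finₚ.≟ j)
... | yes p = p
... | no ¬p = contradiction (Finₚ.injective⇒≤ {f = g} g-inj) ℕₚ.1+n≰n
  where
  j≢f : ∀ i → j ≢ f i
  j≢f i eq = ¬p (i , sym eq)
  g : Fin (suc m) → Fin m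
  g i = punchOut (j≢f i)
  g-inj : Injective _≡_ _≡_ g
  g-inj {x} {y} eq = inj (Finₚ.punchOut-injective (j≢f x) (j≢f y) eq)

module _ {n} (P : Polytope n) where
  open Polytope P

  same-rank : ∀ {F G} → F ≤ G ⊎ G ≤ F → rank F ≡ rank G → F ≡ G
  same-rank {F} {G} cmp eq with F ≟ G
  ... | yes p = p
  ... | no ¬p = [ (λ le → ⊥-elim (Finₚ.<-irrefl eq (rank-mono (le , ¬p))))
                , (λ ge → ⊥-elim (Finₚ.<-irrefl (sym eq) (rank-mono (ge , ¬p ∘ sym)))) ]′ cmp

  rank-reflects : ∀ {F G} → F ≤ G ⊎ G ≤ F → toℕ (rank F) ℕ.< toℕ (rank G) → F < G
  rank-reflects {F} {G} (inj₁ le) lt = le , λ { refl → ℕₚ.<-irrefl refl lt }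
  rank-reflects {F} {G} (inj₂ ge) lt with F ≟ G
  ... | yes refl = ⊥-elim (ℕₚ.<-irrefl refl lt)
  ... | no ¬p    = ⊥-elim (ℕₚ.<-asym lt (rank-mono (ge , ¬p ∘ sym)))

  Σ-≡ : ∀ {C : Face → Bool} {x y : ∃ λ F → F ∈ C} → proj₁ x ≡ proj₁ y → x ≡ y
  Σ-≡ {C} {F , p} {.F , q} refl = cong (F ,_) (T-irrelevant p q)

  face : ∀ (Φ : Flag _≤_) r → ∃ λ F → F ∈ set Φ × rank F ≡ r
  face Φ r = let i , eq = injective⇒hits (rank ∘ proj₁ ∘ at) inj r
             in proj₁ (at i) , proj₂ (at i) , eq
    where
    open Inverse (flag-size Φ) using () renaming (to to index; from to at; inverseˡ to index-at)
    inj : Injective _≡_ _≡_ (rank ∘ proj₁ ∘ at)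
    inj {a} {b} eq = trans (sym (index-at refl)) (trans (cong index ab) (index-at refl))
      where
      ab : at a ≡ at b
      ab = Σ-≡ (same-rank (chain Φ (proj₂ (at a)) (proj₂ (at b))) eq)

  -- The index representing the rank of j-faces, 0 ≤ j ≤ n - 1.
  proper : Fin n → Fin (2 ℕ.+ n)
  proper j = suc (inject₁ j)

  module Replace
    (Φ : Flag _≤_) (r : Fin (2 ℕ.+ n)) (H′ : Face) (rankH′ : rank H′ ≡ r)
    (comparable-H′ : ∀ {F} → rank F ≢ r → F ∈ set Φ → F ≤ H′ ⊎ H′ ≤ F)
    where

    C : Face → Bool
    C F = if ⌊ rank F Finₚ.≟ r ⌋ then ⌊ F ≟ H′ ⌋ else set Φ F

    data InC (F : Face) : Set where
      new : F ≡ H′ → InC F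
      old : rank F ≢ r → F ∈ set Φ → InC F

    view : ∀ {F} → F ∈ C → InC F
    view {F} p with rank F Finₚ.≟ r
    ... | no ¬q = old ¬q p
    ... | yes _ with F ≟ H′
    ...   | yes q = new q
    view {F} () | yes _ | no _

    unview : ∀ {F} → InC F → F ∈ C
    unview {F} (new eq) with rank F Finₚ.≟ r
    ... | no ¬q = ⊥-elim (¬q (trans (cong rank eq) rankH′))
    ... | yes _ with F ≟ H′
    ...   | yes _ = _
    ...   | no ¬q = ⊥-elim (¬q eq)
    unview {F} (old ¬q p) with rank F Finₚ.≟ r
    ... | no _  = p
    ... | yes q = ⊥-elim (¬q q)

    compare : ∀ {F G} → InC F → InC G → F ≤ G ⊎ G ≤ F
    compare (new refl)  (new refl)  = inj₁ ≤-refl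
    compare (new refl)  (old ¬q p)  = swap (comparable-H′ ¬q p)
    compare (old ¬q p)  (new refl)  = comparable-H′ ¬q p
    compare (old _ p)   (old _ q)   = chain Φ p q

    hits : ∀ s → ∃ λ F → F ∈ C × rank F ≡ s
    hits s = by (s Finₚ.≟ r)
      where
      by : Dec (s ≡ r) → ∃ λ F → F ∈ C × rank F ≡ s
      by (yes eq) = H′ , unview (new refl) , trans rankH′ (sym eq)
      by (no ¬q)  = let F , p , e = face Φ s in F , unview (old (λ e′ → ¬q (trans (sym e) e′)) p) , e

    isMaximal : ∀ D → IsChain _≤_ D → C ⊆ D → D ⊆ C
    isMaximal D chainD C⊆D {F} F∈D =
      let G , G∈C , eq = hits (rank F)
      in subst (_∈ C) (same-rank (chainD (C⊆D G∈C) F∈D) eq) G∈C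

    Ψ : Flag _≤_
    Ψ = record { set = C ; chain = λ p q → compare (view p) (view q) ; maximal = isMaximal }

    agree : ∀ F → rank F ≢ r → set Φ F ≡ C F
    agree F ¬q with rank F Finₚ.≟ r
    ... | yes q = ⊥-elim (¬q q)
    ... | no _  = refl

    differ : ∀ {H} → H ∈ set Φ → rank H ≡ r → H′ ≢ H → ¬ (Φ ≋ Ψ)
    differ {H} H∈ rankH H′≢H eq = by (view {H} (subst T (eq H) H∈))
      where
      by : InC H → _
      by (new H≡H′) = H′≢H (sym H≡H′)
      by (old ¬q _) = ¬q rankH

  module Exchange
    (Φ : Flag _≤_) (k : ℕ) {A H B : Face}
    (A∈ : A ∈ set Φ) (H∈ : H ∈ set Φ) (B∈ : B ∈ set Φ)
    (rA : toℕ (rank A) ≡ k) (rH : toℕ (rank H) ≡ suc k) (rB : toℕ (rank B) ≡ 2 ℕ.+ k)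
    where

    A<H : A < H
    A<H = rank-reflects (chain Φ A∈ H∈) (ℕₚ.≤-reflexive (trans (cong suc rA) (sym rH)))
    H<B : H < B
    H<B = rank-reflects (chain Φ H∈ B∈) (ℕₚ.≤-reflexive (trans (cong suc rH) (sym rB)))
    A<B : A < B
    A<B = rank-reflects (chain Φ A∈ B∈) (ℕₚ.<-trans (rank-mono A<H) (rank-mono H<B))

    Between : Pred Face 0ℓ
    Between K = toℕ (rank K) ≡ 1 ℕ.+ toℕ (rank A) × A < K × K < B

    pick : ExactlyTwo Between → ∃ λ K → K ≢ H × Between K
    pick (x , y , x≢y , bx , by , only) with only H (trans rH (cong suc (sym rA)) , A<H , H<B)
    ... | inj₁ H≡x = y , (λ y≡H → x≢y (sym (trans y≡H H≡x))) , by
    ... | inj₂ H≡y = x , (λ x≡H → x≢y (trans x≡H H≡y)) , bx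

    other : ∃ λ K → K ≢ H × Between K
    other = pick (diamond A<B (trans rB (cong (2 ℕ.+_) (sym rA))))

    comparable : ∀ {K} → Between K → ∀ {F} → rank F ≢ rank H → F ∈ set Φ → F ≤ K ⊎ K ≤ F
    comparable {K} (_ , A<K , K<B) {F} ¬q p = by (ℕₚ.<-cmp (toℕ (rank F)) (suc k))
      where
      F≤A : toℕ (rank F) ℕ.< k ⊎ toℕ (rank F) ≡ k → F ≤ A
      F≤A (inj₁ l) = proj₁ (rank-reflects (chain Φ p A∈) (subst (toℕ (rank F) ℕ.<_) (sym rA) l))
      F≤A (inj₂ e) = subst (F ≤_) (same-rank (chain Φ p A∈) (toℕ-injective (trans e (sym rA)))) ≤-refl
      B≤F : 2 ℕ.+ k ℕ.< toℕ (rank F) ⊎ 2 ℕ.+ k ≡ toℕ (rank F) → B ≤ F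
      B≤F (inj₁ l) = proj₁ (rank-reflects (chain Φ B∈ p) (subst (ℕ._< toℕ (rank F)) (sym rB) l))
      B≤F (inj₂ e) = subst (B ≤_) (same-rank (chain Φ B∈ p) (toℕ-injective (trans rB e))) ≤-refl
      by : _ → F ≤ K ⊎ K ≤ F
      by (tri≈ _ eq _) = ⊥-elim (¬q (toℕ-injective (trans eq (sym rH))))
      by (tri< lt _ _) = inj₁ (≤-trans (F≤A (ℕₚ.m≤n⇒m<n∨m≡n (ℕₚ.≤-pred lt))) (proj₁ A<K))
      by (tri> _ _ gt) = inj₂ (≤-trans (proj₁ K<B) (B≤F (ℕₚ.m≤n⇒m<n∨m≡n gt)))

    exchange : ∃ λ Ψ → AdjacentAt rank (rank H) Φ Ψ
    exchange = R.Ψ , R.differ H∈ refl (proj₁ (proj₂ other)) , R.agree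
      where
      module R = Replace Φ (rank H) (proj₁ other)
        (toℕ-injective (trans (proj₁ (proj₂ (proj₂ other))) (trans (cong suc rA) (sym rH))))
        (comparable (proj₂ (proj₂ other)))

  adjacentFlag : ∀ (Φ : Flag _≤_) j → ∃ λ Ψ → AdjacentAt rank (proper j) Φ Ψ
  adjacentFlag Φ j =
    let _ , A∈ , rA = face Φ (inject₁ (inject₁ j))
        _ , H∈ , rH = face Φ (proper j)
        _ , B∈ , rB = face Φ (suc (suc j))
        Ψ , adj = Exchange.exchange Φ (toℕ j) A∈ H∈ B∈
          (trans (cong toℕ rA) (trans (toℕ-inject₁ (inject₁ j)) (toℕ-inject₁ j)))
          (trans (cong toℕ rH) (cong suc (toℕ-inject₁ j)))
          (cong toℕ rB)
    in Ψ , subst (λ r → AdjacentAt rank r Φ Ψ) rH adj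

module _ {n} (P : Polytope n) where
  open Polytope P

  record Automorphism : Set where
    field
      to                 : Face → Face
      isOrderIsomorphism : IsOrderIsomorphism _≡_ _≡_ _≤_ _≤_ to

    open IsOrderIsomorphism isOrderIsomorphism public using (mono; injective; cancel; surjective)

    from : Face → Face
    from F = proj₁ (surjective F)

    to-from : ∀ F → to (from F) ≡ F
    to-from F = proj₂ (surjective F) refl

  open Automorphism

  idAut : Automorphism
  idAut = record
    { to = id ; isOrderIsomorphism = IdentityMorphism.isOrderIsomorphism _≡_ _≤_ refl }

  _then_ : Automorphism → Automorphism → Automorphism
  γ then η = record
    { to = to η ∘ to γ
    ; isOrderIsomorphism =
        ComposeMorphism.isOrderIsomorphism trans (isOrderIsomorphism γ) (isOrderIsomorphism η)
    }

  inverseAut : Automorphism → Automorphism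
  inverseAut γ = record
    { to = from γ
    ; isOrderIsomorphism = record
      { isOrderMonomorphism = record
        { isOrderHomomorphism = record
          { cong = cong (from γ)
          ; mono = λ {F} {G} le → cancel γ
              (subst (_≤ to γ (from γ G)) (sym (to-from γ F))
                (subst (F ≤_) (sym (to-from γ G)) le))
          }
        ; injective = λ {F} {G} eq →
            trans (sym (to-from γ F)) (trans (cong (to γ) eq) (to-from γ G))
        ; cancel = λ {F} {G} le →
            subst (_≤ G) (to-from γ F) (subst (to γ (from γ F) ≤_) (to-from γ G) (mono γ le))
        }
      ; surjective = λ F → to γ F , λ { refl → injective γ (to-from γ (to γ F)) }
      }
    }

  -- Automorphisms act on the right: γ ∙ η applies γ first. With the opposite
  -- convention the σᵢ below would not satisfy (σᵢ ⋯ σⱼ)² = 1.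
  Γ : Group 0ℓ 0ℓ
  Γ = record
    { Carrier = Automorphism
    ; _≈_     = λ γ η → to γ ≗ to η
    ; _∙_     = _then_
    ; ε       = idAut
    ; _⁻¹     = inverseAut
    ; isGroup = record
      { isMonoid = record
        { isSemigroup = record
          { isMagma = record
            { isEquivalence = record
              { refl  = λ _ → refl
              ; sym   = λ p F → sym (p F)
              ; trans = λ p q F → trans (p F) (q F)
              }
            ; ∙-cong = λ {_} {γ′} {η} p q F → trans (cong (to η) (p F)) (q (to γ′ F))
            }
          ; assoc = λ _ _ _ _ → refl
          }
        ; identity = (λ _ _ → refl) , (λ _ _ → refl)
        }
      ; inverse = (λ γ F → to-from γ F) , (λ γ F → injective γ (to-from γ (to γ F)))
      ; ⁻¹-cong = λ {γ} {η} p F →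
          injective η (trans (sym (p (from γ F))) (trans (to-from γ F) (sym (to-from η F))))
      }
    }

  -- Says Ψ = Φγ without forming the image, since γ is bijective.
  Maps : Automorphism → Rel (Flag _≤_) 0ℓ
  Maps γ Φ Ψ = ∀ F → set Φ F ≡ set Ψ (to γ F)

  SameOrbit : Rel (Flag _≤_) 0ℓ
  SameOrbit Φ Ψ = ∃ λ γ → Maps γ Φ Ψ

  record IsChiral : Set where
    field
      two-orbits : ∃₂ λ Φ Ψ → ¬ SameOrbit Φ Ψ × (∀ Θ → SameOrbit Φ Θ ⊎ SameOrbit Ψ Θ)
      adjacent   : ∀ Φ Ψ → Adjacent rank Φ Ψ → ¬ SameOrbit Φ Ψ

  via : ∀ Θ Φ Ψ → SameOrbit Θ Φ → SameOrbit Θ Ψ → SameOrbit Φ Ψ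
  via _ Φ _ (γ , p) (η , q) = inverseAut γ then η , λ F →
    trans (cong (set Φ) (sym (to-from γ F))) (trans (sym (p (from γ F))) (q (from γ F)))

  SameOrbit-adjacent² : IsChiral → ∀ Φ Ψ Θ →
    Adjacent rank Φ Ψ → Adjacent rank Ψ Θ → SameOrbit Φ Θ
  SameOrbit-adjacent² χ Φ Ψ Θ ΦΨ ΨΘ with IsChiral.two-orbits χ
  ... | A , B , _ , cover with cover Φ | cover Ψ | cover Θ
  ... | inj₁ a | _      | inj₁ c = via A Φ Θ a c
  ... | inj₂ a | _      | inj₂ c = via B Φ Θ a c
  ... | inj₁ a | inj₁ b | inj₂ c = ⊥-elim (IsChiral.adjacent χ Φ Ψ ΦΨ (via A Φ Ψ a b))
  ... | inj₁ a | inj₂ b | inj₂ c = ⊥-elim (IsChiral.adjacent χ Ψ Θ ΨΘ (via B Ψ Θ b c))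
  ... | inj₂ a | inj₁ b | inj₁ c = ⊥-elim (IsChiral.adjacent χ Ψ Θ ΨΘ (via A Ψ Θ b c))
  ... | inj₂ a | inj₂ b | inj₁ c = ⊥-elim (IsChiral.adjacent χ Φ Ψ ΦΨ (via B Φ Ψ a b))

record ChiralPolytope (n : ℕ) : Set₁ where
  field
    polytope : Polytope n
    isChiral : IsChiral polytope
    base     : Flag (Polytope._≤_ polytope)

open ChiralPolytope public

-- The generators σ₁, …, σₙ₋₁ are indexed by Fin (n ∸ 1), so that index i
-- stands for the σ with number k = toℕ i + 1; its two ranks are k and k - 1.
upper lower : ∀ {n} → Fin (n ∸ 1) → Fin n
upper {suc n} i = suc i
lower {suc n} i = inject₁ i

module _ {n} (P : ChiralPolytope n) where
  open Polytope (polytope P)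

  -- Φ ↦ Φ^{k,k-1} for k = toℕ i + 1.
  rotation : ∀ i → let Ψ = proj₁ (adjacentFlag (polytope P) (base P) (upper i)) in
             SameOrbit (polytope P) (base P) (proj₁ (adjacentFlag (polytope P) Ψ (lower i)))
  rotation i =
    let Ψ , ΦΨ = adjacentFlag (polytope P) (base P) (upper i)
        Θ , ΨΘ = adjacentFlag (polytope P) Ψ (lower i)
    in SameOrbit-adjacent² (polytope P) (isChiral P) (base P) Ψ Θ (_ , ΦΨ) (_ , ΨΘ)

  σ : Fin (n ∸ 1) → Automorphism (polytope P)
  σ i = proj₁ (rotation i)

Γ⁺ : ∀ {n} → ChiralPolytope n → MarkedGroup (n ∸ 1)
Γ⁺ P = record { group = Γ (polytope P) ; gen = σ P }

-- Base flag Φ⁰. In rank 0 there is no Φ⁰, but also no chiral polytope.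
mirror : ∀ {n} → ChiralPolytope n → ChiralPolytope n
mirror {zero}  P = P
mirror {suc n} P = record
  { polytope = polytope P
  ; isChiral = isChiral P
  ; base     = proj₁ (adjacentFlag (polytope P) (base P) zero)
  }

dualFlag : ∀ {Face : Set} {_≤_ : Rel Face 0ℓ} → Flag _≤_ → Flag (flip _≤_)
dualFlag Φ = record
  { set     = set Φ
  ; chain   = λ p q → swap (chain Φ p q)
  ; maximal = λ D chainD → maximal Φ D (λ p q → swap (chainD p q))
  }

toℕ-opposite : ∀ {m} (i : Fin (suc m)) → toℕ (opposite i) ≡ m ∸ toℕ i
toℕ-opposite i = opposite-prop i

opposite-anti : ∀ {m} {i j : Fin (suc m)} → i Fin.< j → opposite j Fin.< opposite i
opposite-anti {m} {i} {j} i<j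
  rewrite toℕ-opposite i | toℕ-opposite j
  = ℕₚ.∸-monoʳ-< i<j (ℕₚ.≤-pred (Finₚ.toℕ<n j))

opposite-+ : ∀ {m} k (i j : Fin (suc m)) →
             toℕ (opposite j) ≡ k ℕ.+ toℕ (opposite i) → toℕ i ≡ k ℕ.+ toℕ j
opposite-+ {m} k i j eq = ℕₚ.+-cancelʳ-≡ (toℕ (opposite i)) (toℕ i) (k ℕ.+ toℕ j)
  (trans (total i) (trans (sym (total j)) (trans (cong (toℕ j ℕ.+_) eq)
    (trans (sym (ℕₚ.+-assoc (toℕ j) k _)) (cong (ℕ._+ toℕ (opposite i)) (ℕₚ.+-comm (toℕ j) k))))))
  where
  total : ∀ (l : Fin (suc m)) → toℕ l ℕ.+ toℕ (opposite l) ≡ m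
  total l = trans (cong (toℕ l ℕ.+_) (toℕ-opposite l)) (ℕₚ.m+[n∸m]≡n (ℕₚ.≤-pred (Finₚ.toℕ<n l)))

+-opposite : ∀ {m} k (i j : Fin (suc m)) →
             toℕ i ≡ k ℕ.+ toℕ j → toℕ (opposite j) ≡ k ℕ.+ toℕ (opposite i)
+-opposite k i j eq = opposite-+ k (opposite j) (opposite i)
  (trans (cong toℕ (opposite-involutive i))
    (trans eq (cong (λ l → k ℕ.+ toℕ l) (sym (opposite-involutive j)))))

dualPolytope : ∀ {n} → Polytope n → Polytope n
dualPolytope {n} P = record
  { Face              = Face
  ; _≤_               = flip _≤_
  ; isDecPartialOrder = record
    { isPartialOrder = Flip.isPartialOrder isPartialOrder
    ; _≟_            = _≟_
    ; _≤?_           = flip _≤?_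
    }
  ; rank              = opposite ∘ rank
  ; rank-mono         = λ { (le , ne) → opposite-anti (rank-mono (le , ne ∘ sym)) }
  ; least             = greatest
  ; least-minimum     = greatest-maximum
  ; least-rank        = trans (cong opposite greatest-rank) (opposite-involutive zero)
  ; greatest          = least
  ; greatest-maximum  = least-minimum
  ; greatest-rank     = cong opposite least-rank
  ; flag-size         = λ Φ → flag-size (dualFlag Φ)
  ; diamond           = diamond′
  ; strongly-flag-connected = connected
  }
  where
  open Polytope P

  diamond′ : ∀ {F G} → G ≤ F × F ≢ G →
             toℕ (opposite (rank G)) ≡ 2 ℕ.+ toℕ (opposite (rank F)) →
             ExactlyTwo λ H → toℕ (opposite (rank H)) ≡ 1 ℕ.+ toℕ (opposite (rank F)) ×
                              (H ≤ F × F ≢ H) × (G ≤ H × H ≢ G)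
  diamond′ {F} {G} (le , ne) eq =
    let rF = opposite-+ 2 (rank F) (rank G) eq
        x , y , x≢y , bx , by , only = diamond (le , ne ∘ sym) rF
    in x , y , x≢y , forth rF bx , forth rF by , λ z bz → only z (back rF bz)
    where
    forth : toℕ (rank F) ≡ 2 ℕ.+ toℕ (rank G) → ∀ {H} →
            toℕ (rank H) ≡ 1 ℕ.+ toℕ (rank G) × G < H × H < F →
            toℕ (opposite (rank H)) ≡ 1 ℕ.+ toℕ (opposite (rank F)) ×
            (H ≤ F × F ≢ H) × (G ≤ H × H ≢ G)
    forth rF {H} (rH , (gh , g≢h) , (hf , h≢f)) =
      +-opposite 1 (rank F) (rank H) (trans rF (cong suc (sym rH))) ,
      (hf , h≢f ∘ sym) , (gh , g≢h ∘ sym)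
    back : toℕ (rank F) ≡ 2 ℕ.+ toℕ (rank G) → ∀ {H} →
           toℕ (opposite (rank H)) ≡ 1 ℕ.+ toℕ (opposite (rank F)) ×
           (H ≤ F × F ≢ H) × (G ≤ H × H ≢ G) →
           toℕ (rank H) ≡ 1 ℕ.+ toℕ (rank G) × G < H × H < F
    back rF {H} (rH , (hf , f≢h) , (gh , h≢g)) =
      ℕₚ.suc-injective (trans (sym (opposite-+ 1 (rank F) (rank H) rH)) rF) ,
      (gh , h≢g ∘ sym) , (hf , f≢h ∘ sym)

  step : ∀ Φ Ψ {Θ Θ′} → Step rank (dualFlag Φ) (dualFlag Ψ) Θ Θ′ →
         Step (opposite ∘ rank) Φ Ψ (dualFlag Θ) (dualFlag Θ′)
  step _ _ ((j , ne , eq) , inc) =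
    (opposite j , ne , λ F r≢ → eq F (r≢ ∘ cong opposite)) , inc

  connected : ∀ (Φ Ψ : Flag (flip _≤_)) →
              ∃ λ Ψ′ → Star (Step (opposite ∘ rank) Φ Ψ) Φ Ψ′ × Ψ′ ≋ Ψ
  connected Φ Ψ with strongly-flag-connected (dualFlag Φ) (dualFlag Ψ)
  ... | _  , Star.ε     , eq = Φ , Star.ε , eq
  ... | Ψ′ , _◅_ {j = Θ} s path , eq =
    dualFlag Ψ′ , step Φ Ψ {dualFlag Φ} {Θ} s ◅ gmap dualFlag (λ {Θ} {Θ′} → step Φ Ψ {Θ} {Θ′}) path , eq

dualAutomorphism : ∀ {n} (P : Polytope n) → Automorphism P → Automorphism (dualPolytope P)
dualAutomorphism P γ = record
  { to = to
  ; isOrderIsomorphism = record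
    { isOrderMonomorphism = record
      { isOrderHomomorphism = record { cong = cong to ; mono = mono }
      ; injective = injective
      ; cancel    = cancel
      }
    ; surjective = surjective
    }
  }
  where open Automorphism γ

undualAutomorphism : ∀ {n} (P : Polytope n) → Automorphism (dualPolytope P) → Automorphism P
undualAutomorphism P γ = record
  { to = to
  ; isOrderIsomorphism = record
    { isOrderMonomorphism = record
      { isOrderHomomorphism = record { cong = cong to ; mono = mono }
      ; injective = injective
      ; cancel    = cancel
      }
    ; surjective = surjective
    }
  }
  where open Automorphism γ

dual : ∀ {n} → ChiralPolytope n → ChiralPolytope n
dual P = record
  { polytope = dualPolytope (polytope P)
  ; isChiral = record
    { two-orbits =
        let Φ , Ψ , ne , cover = IsChiral.two-orbits (isChiral P)
        in dualFlag Φ , dualFlag Ψ ,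
           (λ { (γ , p) → ne (undualAutomorphism (polytope P) γ , p) }) ,
           λ Θ → [ (λ { (γ , p) → inj₁ (dualAutomorphism (polytope P) γ , p) })
                 , (λ { (γ , p) → inj₂ (dualAutomorphism (polytope P) γ , p) }) ]′ (cover (dualFlag Θ))
    ; adjacent = λ { Φ Ψ (j , ne , eq) (γ , p) →
        IsChiral.adjacent (isChiral P) (dualFlag Φ) (dualFlag Ψ)
          (opposite j , ne , λ F r≢ → eq F λ r≡ →
             r≢ (trans (sym (opposite-involutive (rank F))) (cong opposite r≡)))
          (undualAutomorphism (polytope P) γ , p) }
    }
  ; base = dualFlag (base P)
  }
  where open Polytope (polytope P)

-- σᵢ σᵢ₊₁ ⋯ σⱼ
segment : ∀ {m} → Fin m → Fin m → Term (Fin m)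
segment {m} i j =
  foldr (λ k t → var k · t) 𝟙 (filter (λ k → (i Finₚ.≤? k) ×-dec (k Finₚ.≤? j)) (allFin m))

data W⁺Relator {m} : Pred (Term (Fin m)) 0ℓ where
  involution : ∀ {i j} → i Fin.< j → W⁺Relator (segment i j · segment i j)

W⁺ : ℕ → Group 0ℓ 0ℓ
W⁺ n = ⟨ Fin (n ∸ 1) ∣ W⁺Relator ⟩

barGen : ∀ {m} → Fin m → Term (Fin m)
barGen zero          = inv (var zero)
barGen (suc zero)    = (var zero · var zero) · var (suc zero)
barGen (suc (suc k)) = var (suc (suc k))

bar : ∀ {m} → Term (Fin m) → Term (Fin m)
bar t = t >>= barGen

-- For G satisfying the relations of W⁺, the kernel of the epimorphism from W⁺
-- onto G that preserves the specified generators.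
Kernel : ∀ n → MarkedGroup (n ∸ 1) → Pred (Group.Carrier (W⁺ n)) 0ℓ
Kernel n G w = MarkedGroup.Relator G w

Bar : ∀ n → Pred (Group.Carrier (W⁺ n)) 0ℓ → Pred (Group.Carrier (W⁺ n)) 0ℓ
Bar n N v = ∃ λ w → N w × Group._≈_ (W⁺ n) v (bar w)

MixIsChiral : ∀ {n} → ChiralPolytope n → ChiralPolytope n → Set
MixIsChiral {n} P Q = ¬ (Bar n N ≐ N)
  where
  N : Pred (Group.Carrier (W⁺ n)) 0ℓ
  N = Kernel n (Γ⁺ P ◇ Γ⁺ Q)

{-# OPTIONS --safe #-}

-- Write Γ⁺(P) = W/M, A = M ∩ M̄ and B = δ(M) ∩ δ(M̄). If N = M ∩ δ(M) is invariant
-- under bar, then N = A ∩ B. Given x mod A and y mod B, let z represent x⁻¹y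
-- modulo AB; the cosets xzA and yB then meet, and they meet in a single coset wN.
-- So (x , y) is determined by z and by w modulo M and δ(M), which gives
-- a² ≤ c b². Constructively, w is read off a derivation of equality in the comix.
--
-- The identification of the groups of the mirror image and the dual with W/M̄ and
-- W/δ(M) rests on rigidity: an automorphism is determined by the image of one flag.

module Submission where

open import Algebra.Bundles using (Group)
import Algebra.Construct.DirectProduct as DirectProduct
import Algebra.Properties.Group as GroupProperties
open import Data.Bool.Base using (Bool; true; false; T; _∨_)
open import Data.Bool.Properties using (T-∨; T?)
open import Data.Empty using (⊥-elim)
open import Data.Fin.Base as Fin using (Fin; zero; suc; toℕ; fromℕ; inject₁; opposite; combine; remQuot)
open import Data.Fin.Properties as Finₚ using (toℕ-inject₁; toℕ-injective)
open import Data.Fin.Relation.Unary.Top using (view; ‵fromℕ; ‵inject₁)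
open import Data.Integer.Base as ℤ using (+_)
import Data.Integer.Properties as ℤₚ
open import Data.List.Base using ([]; _∷_; tabulate)
open import Data.List.Membership.Propositional using () renaming (_∈_ to _∈ₗ_)
open import Data.List.Membership.Propositional.Properties using (∈-tabulate⁺)
open import Data.List.Relation.Unary.Any using (here; there)
open import Data.Nat.Base as ℕ using (ℕ; zero; suc; NonZero)
import Data.Nat.Properties as ℕₚ
open import Data.Product.Base using (∃; _×_; _,_; proj₁; proj₂)
open import Data.Rational.Unnormalised.Base using (_/_; _*_; _>_; *<*)
open import Data.Sum.Base using (_⊎_; inj₁; inj₂; [_,_]′; swap)
open import Function.Base using (_∘_; id)
open import Function.Bundles using (Inverse; Equivalence)
open import Function.Definitions using (Injective)
open import Relation.Binary.Construct.Closure.ReflexiveTransitive using (Star; _◅_) renaming (ε to done)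
open import Relation.Binary.PropositionalEquality using (_≡_; _≢_; refl; sym; trans; cong; cong₂; subst; subst₂)
open import Relation.Nullary using (Dec; yes; no; contradiction)
open import Relation.Nullary.Decidable using (⌊_⌋; toWitness; fromWitness; map′; _→-dec_; _⊎-dec_)
open import Defs

T-injective : ∀ {a b} → (T a → T b) → (T b → T a) → a ≡ b
T-injective {false} {false} _ _ = refl
T-injective {false} {true}  _ g = ⊥-elim (g _)
T-injective {true}  {false} f _ = ⊥-elim (f _)
T-injective {true}  {true}  _ _ = refl

-- Flags of a finite polytope.

module Flags {n} (P : Polytope n) (finite : Finite P) where
  open Polytope P
  open Automorphism
  open Inverse (proj₂ finite) using () renaming (to to index; from to at; inverseʳ to at-index)

  Comparable : Face → (Face → Bool) → Set
  Comparable G C = ∀ {F} → F ∈ C → F ≤ G ⊎ G ≤ F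

  -- `Comparable` quantifies over all faces, so its decision runs through the enumeration of the
  -- finite face set.
  comparable? : ∀ G C → Dec (Comparable G C)
  comparable? G C = map′
    (λ h {F} F∈C → subst (λ K → K ≤ G ⊎ G ≤ K) (at-index refl)
       (h (index F) (subst (_∈ C) (sym (at-index refl)) F∈C)))
    (λ h i → h)
    (Finₚ.all? λ i → T? (C (at i)) →-dec ((at i ≤? G) ⊎-dec (G ≤? at i)))

  insert : Face → (Face → Bool) → Face → Bool
  insert G C F = ⌊ F ≟ G ⌋ ∨ C F

  insert-split : ∀ {G C F} → F ∈ insert G C → F ≡ G ⊎ F ∈ C
  insert-split {G} {C} {F} p with Equivalence.to (T-∨ {⌊ F ≟ G ⌋}) p
  ... | inj₁ q = inj₁ (toWitness q)
  ... | inj₂ q = inj₂ q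

  ∈-insert : ∀ G C → G ∈ insert G C
  ∈-insert G C = Equivalence.from (T-∨ {⌊ G ≟ G ⌋}) (inj₁ (fromWitness refl))

  ⊆-insert : ∀ G C → C ⊆ insert G C
  ⊆-insert G C {F} p = Equivalence.from (T-∨ {⌊ F ≟ G ⌋}) (inj₂ p)

  insert-chain : ∀ {G C} → IsChain _≤_ C → Comparable G C → IsChain _≤_ (insert G C)
  insert-chain {G} {C} chainC G~C {F} {F′} p q
    with insert-split {G} {C} {F} p | insert-split {G} {C} {F′} q
  ... | inj₁ refl | inj₁ refl = inj₁ ≤-refl
  ... | inj₁ refl | inj₂ q′   = swap (G~C q′)
  ... | inj₂ p′   | inj₁ refl = G~C p′
  ... | inj₂ p′   | inj₂ q′   = chainC p′ q′

  -- A greedy pass over the list: a face rejected by the current chain is rejected by every larger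
  -- chain, so one look at each face is enough.
  saturate : ∀ Gs C → IsChain _≤_ C →
             ∃ λ D → IsChain _≤_ D × C ⊆ D × (∀ {G} → G ∈ₗ Gs → Comparable G D → G ∈ D)
  saturate []       C chainC = C , chainC , id , λ ()
  saturate (G ∷ Gs) C chainC with comparable? G C
  ... | yes G~C =
    let D , chainD , C⊆D , sat = saturate Gs (insert G C) (insert-chain chainC G~C)
    in D , chainD , (λ {F} p → C⊆D (⊆-insert G C {F} p)) ,
       λ { (here refl) _ → C⊆D (∈-insert G C) ; (there m) → sat m }
  ... | no G≁C =
    let D , chainD , C⊆D , sat = saturate Gs C chainC
    in D , chainD , C⊆D ,
       λ { (here refl) G~D → ⊥-elim (G≁C (λ p → G~D (C⊆D p))) ; (there m) → sat m }

  -- The chain consisting of `F` is saturated over all faces. A face of a larger chain is comparable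
  -- with every member, hence was already taken, which is maximality.
  flag-through : ∀ F → ∃ λ (Φ : Flag _≤_) → F ∈ set Φ
  flag-through F =
    let D , chainD , F∈D , sat = saturate (tabulate at) (λ G → ⌊ G ≟ F ⌋) singleton
    in record { set = D ; chain = chainD
              ; maximal = λ E chainE D⊆E {G} G∈E → sat
                  (subst (_∈ₗ tabulate at) (at-index refl) (∈-tabulate⁺ {f = at} (index G)))
                  (λ K∈D → chainE (D⊆E K∈D) G∈E) } ,
       F∈D (fromWitness refl)
    where
    singleton : IsChain _≤_ (λ G → ⌊ G ≟ F ⌋)
    singleton {G} {G′} p q with toWitness p | toWitness q
    ... | refl | refl = inj₁ ≤-refl

  -- A flag through `F` supplies a face one rank lower; its image is strictly below that of `F`, so
  -- the rank of the image grows by at least one at each step of the induction.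
  rank-≤-image : ∀ (γ : Automorphism P) k F → toℕ (rank F) ≡ k → k ℕ.≤ toℕ (rank (to γ F))
  rank-≤-image γ zero    F eq = ℕ.z≤n
  rank-≤-image γ (suc k) F eq =
    let Φ , F∈Φ        = flag-through F
        k<             = ℕₚ.<-trans (ℕₚ.≤-reflexive (sym eq)) (Finₚ.toℕ<n (rank F))
        G , G∈Φ , rG   = face P Φ (Fin.fromℕ< k<)
        rG≡k           = trans (cong toℕ rG) (Finₚ.toℕ-fromℕ< k<)
        G≤F , G≢F      = rank-reflects P (chain Φ G∈Φ F∈Φ)
                           (ℕₚ.≤-reflexive (trans (cong suc rG≡k) (sym eq)))
    in ℕₚ.≤-trans (ℕ.s≤s (rank-≤-image γ k G rG≡k))
                  (rank-mono (mono γ G≤F , G≢F ∘ injective γ))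

  rank-invariant : ∀ (γ : Automorphism P) F → rank (to γ F) ≡ rank F
  rank-invariant γ F = toℕ-injective (ℕₚ.≤-antisym
    -- The reverse inequality is the same bound for the inverse of γ, applied to the image of `F`.
    (subst (λ G → toℕ (rank (to γ F)) ℕ.≤ toℕ (rank G)) (injective γ (to-from γ (to γ F)))
      (rank-≤-image (inverseAut P γ) _ (to γ F) refl))
    (rank-≤-image γ _ F refl))

  -- Wrapped in a record because Φ ≋ Ψ and Maps unfold to statements about the
  -- underlying sets, from which the flags themselves cannot be inferred.
  infix 4 _≃_
  record _≃_ (Φ Ψ : Flag _≤_) : Set where
    constructor mk≃
    field same : Φ ≋ Ψ
  open _≃_ public

  record Sends (γ : Automorphism P) (Φ Ψ : Flag _≤_) : Set where
    constructor mkSends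
    field maps : Maps P γ Φ Ψ
  open Sends public

  ≃-refl : ∀ {Φ} → Φ ≃ Φ
  ≃-refl = mk≃ λ _ → refl

  ≃-sym : ∀ {Φ Ψ} → Φ ≃ Ψ → Ψ ≃ Φ
  ≃-sym p = mk≃ λ F → sym (same p F)

  ≃-trans : ∀ {Φ Ψ Θ} → Φ ≃ Ψ → Ψ ≃ Θ → Φ ≃ Θ
  ≃-trans p q = mk≃ λ F → trans (same p F) (same q F)

  ⊆⇒≃ : ∀ Φ Ψ → set Φ ⊆ set Ψ → Φ ≃ Ψ
  ⊆⇒≃ Φ Ψ Φ⊆Ψ = mk≃ λ F → T-injective Φ⊆Ψ (maximal Φ (set Ψ) (chain Ψ) Φ⊆Ψ)

  unique-face : ∀ (Φ : Flag _≤_) {F G} → F ∈ set Φ → G ∈ set Φ → rank F ≡ rank G → F ≡ G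
  unique-face Φ F∈ G∈ = same-rank P (chain Φ F∈ G∈)

  -- Uniqueness of adjacent flags.

  AdjacentAt-sym : ∀ {r} Φ Ψ → AdjacentAt {_≤_ = _≤_} rank r Φ Ψ → AdjacentAt rank r Ψ Φ
  AdjacentAt-sym Φ Ψ (ne , eq) = (λ Ψ≋Φ → ne (sym ∘ Ψ≋Φ)) , λ F r≢ → sym (eq F r≢)

  module _ {r} (Φ Ψ : Flag _≤_) (ΦΨ : AdjacentAt rank r Φ Ψ) where

    shared : ∀ {F} → rank F ≢ r → F ∈ set Φ → F ∈ set Ψ
    shared {F} r≢ = subst T (proj₂ ΦΨ F r≢)

    -- All faces of other ranks are shared. A common face at rank `r` would give Φ ⊆ Ψ, and
    -- maximality would make the flags equal.
    changed-face : ∀ {K H} → K ∈ set Φ → rank K ≡ r → H ∈ set Ψ → rank H ≡ r → H ≢ K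
    changed-face {K} K∈Φ rK H∈Ψ rH refl = proj₁ ΦΨ (same (⊆⇒≃ Φ Ψ Φ⊆Ψ))
      where
      Φ⊆Ψ : set Φ ⊆ set Ψ
      Φ⊆Ψ {F} F∈Φ with rank F Finₚ.≟ r
      ... | yes rF = subst (_∈ set Ψ) (unique-face Φ K∈Φ F∈Φ (trans rK (sym rF))) H∈Ψ
      ... | no  r≢ = shared r≢ F∈Φ

  ExactlyTwo-other : ∀ {Q : Face → Set} → ExactlyTwo Q → ∀ {K H H′} → Q K → Q H → Q H′ →
                     H ≢ K → H′ ≢ K → H ≡ H′
  ExactlyTwo-other (_ , _ , _ , _ , _ , only) {K} {H} {H′} qK qH qH′ H≢K H′≢K
    with only K qK | only H qH | only H′ qH′
  ... | _         | inj₁ refl | inj₁ refl = refl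
  ... | _         | inj₂ refl | inj₂ refl = refl
  ... | inj₁ refl | inj₁ refl | inj₂ refl = ⊥-elim (H≢K refl)
  ... | inj₁ refl | inj₂ refl | inj₁ refl = ⊥-elim (H′≢K refl)
  ... | inj₂ refl | inj₁ refl | inj₂ refl = ⊥-elim (H′≢K refl)
  ... | inj₂ refl | inj₂ refl | inj₁ refl = ⊥-elim (H≢K refl)

  toℕ-proper : ∀ j → toℕ (proper P j) ≡ suc (toℕ j)
  toℕ-proper j = cong suc (toℕ-inject₁ j)

  -- The new j-face depends only on the faces of ranks j - 1, j and j + 1.
  exchanged-face : ∀ j Φ Ψ Φ′ Ψ′ →
    AdjacentAt {_≤_ = _≤_} rank (proper P j) Φ Ψ → AdjacentAt rank (proper P j) Φ′ Ψ′ →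
    (∀ {F} → toℕ (rank F) ℕ.≤ 2 ℕ.+ toℕ j → F ∈ set Φ → F ∈ set Φ′) →
    ∀ {H H′} → H ∈ set Ψ → rank H ≡ proper P j → H′ ∈ set Ψ′ → rank H′ ≡ proper P j → H ≡ H′
  exchanged-face j Φ Ψ Φ′ Ψ′ adj adj′ agree {H} {H′} H∈ rH H′∈ rH′ =
    -- The old face `K` and both new faces lie in the diamond between `A` and `B`, and the new ones
    -- differ from `K`.
    ExactlyTwo-other (diamond EK.A<B (trans rB (cong (2 ℕ.+_) (sym rA))))
      (between EK.A<H EK.H<B rK) (between EH.A<H EH.H<B rH) (between EH′.A<H EH′.H<B rH′)
      (changed-face Φ Ψ adj K∈ rK H∈ rH)
      (changed-face Φ′ Ψ′ adj′ (agree K≤ K∈) rK H′∈ rH′)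
    where
    -- Rank indices are shifted by one: ranks j - 1, j and j + 1 have indices j, j + 1 and j + 2.
    a = face P Φ (inject₁ (inject₁ j))
    k = face P Φ (proper P j)
    b = face P Φ (suc (suc j))
    A = proj₁ a
    K = proj₁ k
    B = proj₁ b
    A∈ = proj₁ (proj₂ a)
    K∈ = proj₁ (proj₂ k)
    B∈ = proj₁ (proj₂ b)
    rK : rank K ≡ proper P j
    rK = proj₂ (proj₂ k)
    rA : toℕ (rank A) ≡ toℕ j
    rA = trans (cong toℕ (proj₂ (proj₂ a))) (trans (toℕ-inject₁ (inject₁ j)) (toℕ-inject₁ j))
    rB : toℕ (rank B) ≡ 2 ℕ.+ toℕ j
    rB = cong toℕ (proj₂ (proj₂ b))
    rank≡ : ∀ {F} → rank F ≡ proper P j → toℕ (rank F) ≡ suc (toℕ j)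
    rank≡ eq = trans (cong toℕ eq) (toℕ-proper j)
    A≢ : rank A ≢ proper P j
    A≢ eq = ℕₚ.1+n≢n (trans (sym (rank≡ eq)) rA)
    B≢ : rank B ≢ proper P j
    B≢ eq = ℕₚ.1+n≢n (trans (sym rB) (rank≡ eq))
    A≤ : toℕ (rank A) ℕ.≤ 2 ℕ.+ toℕ j
    A≤ = ℕₚ.≤-trans (ℕₚ.≤-reflexive rA) (ℕₚ.m≤n+m (toℕ j) 2)
    K≤ : toℕ (rank K) ℕ.≤ 2 ℕ.+ toℕ j
    K≤ = ℕₚ.≤-trans (ℕₚ.≤-reflexive (rank≡ rK)) (ℕₚ.n≤1+n _)
    module EK = Exchange P Φ (toℕ j) A∈ K∈ B∈ rA (rank≡ rK) rB
    module EH = Exchange P Ψ (toℕ j) (shared Φ Ψ adj A≢ A∈) H∈ (shared Φ Ψ adj B≢ B∈)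
                  rA (rank≡ rH) rB
    module EH′ = Exchange P Ψ′ (toℕ j) (shared Φ′ Ψ′ adj′ A≢ (agree A≤ A∈)) H′∈
                  (shared Φ′ Ψ′ adj′ B≢ (agree (ℕₚ.≤-reflexive rB) B∈)) rA (rank≡ rH′) rB
    between : ∀ {F} → A < F → F < B → rank F ≡ proper P j →
              toℕ (rank F) ≡ 1 ℕ.+ toℕ (rank A) × A < F × F < B
    between A<F F<B rF = trans (rank≡ rF) (cong suc (sym rA)) , A<F , F<B

  rank-zero : ∀ {F} → rank F ≡ zero → F ≡ least
  rank-zero {F} eq = same-rank P (inj₂ (least-minimum F)) (trans eq (sym least-rank))

  rank-top : ∀ {F} → rank F ≡ fromℕ (suc n) → F ≡ greatest
  rank-top {F} eq = same-rank P (inj₁ (greatest-maximum F)) (trans eq (sym greatest-rank))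

  -- Away from `r` nothing changes. At `r` the new face is forced: by the diamond condition for a
  -- proper rank, and as the least or greatest face otherwise.
  adjacent-unique : ∀ r {Φ Ψ Φ′ Ψ′} → Φ ≃ Φ′ →
                    AdjacentAt rank r Φ Ψ → AdjacentAt rank r Φ′ Ψ′ → Ψ ≃ Ψ′
  adjacent-unique r {Φ} {Ψ} {Φ′} {Ψ′} Φ≃Φ′ adj adj′ = ⊆⇒≃ Ψ Ψ′ Ψ⊆Ψ′
    where
    same-face : ∀ r → AdjacentAt rank r Φ Ψ → AdjacentAt rank r Φ′ Ψ′ → ∀ {H H′} →
                H ∈ set Ψ → rank H ≡ r → H′ ∈ set Ψ′ → rank H′ ≡ r → H ≡ H′
    same-face zero _ _ _ rH _ rH′ = trans (rank-zero rH) (sym (rank-zero rH′))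
    same-face (suc i) adj adj′ H∈ rH H′∈ rH′ with view i
    ... | ‵fromℕ     = trans (rank-top rH) (sym (rank-top rH′))
    ... | ‵inject₁ j = exchanged-face j Φ Ψ Φ′ Ψ′ adj adj′ (λ {F} _ → subst T (same Φ≃Φ′ F))
                         H∈ rH H′∈ rH′
    Ψ⊆Ψ′ : set Ψ ⊆ set Ψ′
    Ψ⊆Ψ′ {F} F∈ with rank F Finₚ.≟ r
    ... | no r≢ = subst T (trans (sym (proj₂ adj F r≢)) (trans (same Φ≃Φ′ F) (proj₂ adj′ F r≢))) F∈
    ... | yes rF = let H′ , H′∈ , rH′ = face P Ψ′ r in
      subst (_∈ set Ψ′) (sym (same-face r adj adj′ F∈ rF H′∈ rH′)) H′∈

  -- The exchange maps Φ ↦ Φ^j.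

  infixl 8 _^_
  abstract
    -- Kept abstract: the arguments below rest on adjacency and its uniqueness, never on how the
    -- adjacent flag is built.
    _^_ : Flag _≤_ → Fin n → Flag _≤_
    Φ ^ j = proj₁ (adjacentFlag P Φ j)

    ^-adjacent : ∀ Φ j → AdjacentAt rank (proper P j) Φ (Φ ^ j)
    ^-adjacent Φ j = proj₂ (adjacentFlag P Φ j)

  -- Connects the concrete flags in the definitions of `rotation` and `mirror` with the abstract
  -- exchange maps.
  adjacentFlag≃^ : ∀ {Φ Ψ} j → Φ ≃ Ψ → proj₁ (adjacentFlag P Φ j) ≃ Ψ ^ j
  adjacentFlag≃^ {Φ} {Ψ} j eq =
    adjacent-unique (proper P j) eq (proj₂ (adjacentFlag P Φ j)) (^-adjacent Ψ j)

  ^-unique : ∀ {Φ Ψ} j → AdjacentAt rank (proper P j) Φ Ψ → Φ ^ j ≃ Ψ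
  ^-unique {Φ} j adj = adjacent-unique (proper P j) (≃-refl {Φ}) (^-adjacent Φ j) adj

  ^-cong : ∀ {Φ Ψ} j → Φ ≃ Ψ → Φ ^ j ≃ Ψ ^ j
  ^-cong {Φ} {Ψ} j eq = adjacent-unique (proper P j) eq (^-adjacent Φ j) (^-adjacent Ψ j)

  ^-involutive : ∀ Φ j → Φ ^ j ^ j ≃ Φ
  ^-involutive Φ j = ^-unique j (AdjacentAt-sym Φ (Φ ^ j) (^-adjacent Φ j))

  -- Exchanging the j-face leaves ranks i - 1, i and i + 1 alone, so the exchange at i produces the
  -- same i-face before and after it. Hence Φ^i and Φ^{j,i} are j-adjacent.
  ^-comm : ∀ Φ {i j} → suc (toℕ i) ℕ.< toℕ j → Φ ^ i ^ j ≃ Φ ^ j ^ i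
  ^-comm Φ {i} {j} i<j = ^-unique j (differ , agree)
    where
    far : ∀ {F} → toℕ (rank F) ℕ.≤ 2 ℕ.+ toℕ i → rank F ≢ proper P j
    far {F} le eq = ℕₚ.<-irrefl refl (ℕₚ.<-≤-trans (ℕ.s≤s i<j)
      (subst (ℕ._≤ 2 ℕ.+ toℕ i) (trans (cong toℕ eq) (toℕ-proper j)) le))
    j≢i : ∀ {F} → rank F ≡ proper P i → rank F ≢ proper P j
    j≢i eq = far (ℕₚ.≤-trans (ℕₚ.≤-reflexive (trans (cong toℕ eq) (toℕ-proper i))) (ℕₚ.n≤1+n _))
    adjᵢ  = ^-adjacent Φ i
    adjⱼ  = ^-adjacent Φ j
    adjⱼᵢ = ^-adjacent (Φ ^ j) i
    agree : ∀ F → rank F ≢ proper P j → set (Φ ^ i) F ≡ set (Φ ^ j ^ i) F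
    agree F r≢j with rank F Finₚ.≟ proper P i
    ... | no r≢i = trans (sym (proj₂ adjᵢ F r≢i)) (trans (proj₂ adjⱼ F r≢j) (proj₂ adjⱼᵢ F r≢i))
    ... | yes rF = T-injective
      (λ F∈ → subst (_∈ set (Φ ^ j ^ i)) (sym (eq F∈)) H∈)
      (λ F∈ → subst (_∈ set (Φ ^ i)) (exchange K∈ rK F∈ rF) K∈)
      where
      exchange = exchanged-face i Φ (Φ ^ i) (Φ ^ j) (Φ ^ j ^ i) adjᵢ adjⱼᵢ
                   (λ le → shared Φ (Φ ^ j) adjⱼ (far le))
      h = face P (Φ ^ j ^ i) (proper P i)
      H∈ = proj₁ (proj₂ h)
      k = face P (Φ ^ i) (proper P i)
      K∈ = proj₁ (proj₂ k)
      rK = proj₂ (proj₂ k)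
      eq : F ∈ set (Φ ^ i) → F ≡ proj₁ h
      eq F∈ = exchange F∈ rF H∈ (proj₂ (proj₂ h))
    differ : (Φ ^ i) ≋ (Φ ^ j ^ i) → _
    -- The exchanges at i do not touch the j-face, so equality here would force Φ and Φ^j to agree
    -- at rank j as well.
    differ eq = proj₁ adjⱼ Φ≋
      where
      Φ≋ : Φ ≋ (Φ ^ j)
      Φ≋ F with rank F Finₚ.≟ proper P j
      ... | no r≢ = proj₂ adjⱼ F r≢
      ... | yes rF = trans (proj₂ adjᵢ F r≢i) (trans (eq F) (sym (proj₂ adjⱼᵢ F r≢i)))
        where
        r≢i : rank F ≢ proper P i
        r≢i rF′ = j≢i rF′ rF

  -- The action of automorphisms on flags.

  preimage : Automorphism P → Flag _≤_ → Flag _≤_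
  preimage γ Ψ = record
    { set     = set Ψ ∘ to γ
    ; chain   = λ p q → [ inj₁ ∘ cancel γ , inj₂ ∘ cancel γ ]′ (chain Ψ p q)
    ; maximal = λ D chainD Ψγ⊆D {F} F∈D →
        maximal Ψ (D ∘ from γ)
          (λ p q → [ inj₁ ∘ cancel (inverseAut P γ) , inj₂ ∘ cancel (inverseAut P γ) ]′ (chainD p q))
          (λ {G} G∈Ψ → Ψγ⊆D (subst (_∈ set Ψ) (sym (to-from γ G)) G∈Ψ))
          (subst (_∈ D) (sym (injective γ (to-from γ (to γ F)))) F∈D)
    }

  preimage-adjacent : ∀ (γ : Automorphism P) {r} Φ Ψ → AdjacentAt rank r Φ Ψ →
                      AdjacentAt rank r (preimage γ Φ) (preimage γ Ψ)
  preimage-adjacent γ Φ Ψ (ne , eq) =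
    (λ e → ne λ F → subst (λ G → set Φ G ≡ set Ψ G) (to-from γ F) (e (from γ F))) ,
    λ F r≢ → eq (to γ F) (r≢ ∘ trans (sym (rank-invariant γ F)))

  -- Automorphisms commute with exchanges: `Sends γ Φ Ψ` makes Φ the preimage of Ψ, the preimage of
  -- Ψ^j is j-adjacent to it because ranks are preserved, and adjacent flags are unique.
  sends-^ : ∀ {γ Φ Ψ} j → Sends γ Φ Ψ → Sends γ (Φ ^ j) (Ψ ^ j)
  sends-^ {γ} {Φ} {Ψ} j s = mkSends (same (adjacent-unique (proper P j)
    {Φ} {Φ ^ j} {preimage γ Ψ} {preimage γ (Ψ ^ j)} (mk≃ (maps s))
    (^-adjacent Φ j) (preimage-adjacent γ Ψ (Ψ ^ j) (^-adjacent Ψ j))))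

  sends-resp : ∀ {γ Φ Φ′ Ψ Ψ′} → Φ ≃ Φ′ → Ψ ≃ Ψ′ → Sends γ Φ Ψ → Sends γ Φ′ Ψ′
  sends-resp {γ} p q s = mkSends λ F →
    trans (sym (same p F)) (trans (maps s F) (same q (to γ F)))

  infixr 5 _⨾_
  _⨾_ : ∀ {γ η Φ Ψ Θ} → Sends γ Φ Ψ → Sends η Ψ Θ → Sends (_then_ P γ η) Φ Θ
  _⨾_ {γ} s t = mkSends λ F → trans (maps s F) (maps t (to γ F))

  sends-inverse : ∀ {γ Φ Ψ} → Sends γ Φ Ψ → Sends (inverseAut P γ) Ψ Φ
  sends-inverse {γ} {Φ} {Ψ} s = mkSends λ F →
    trans (cong (set Ψ) (sym (to-from γ F))) (sym (maps s (from γ F)))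

  -- The inverse sends Φ^{i,j} to Φ; exchanging at j and then at i on both sides cancels on the left
  -- and leaves Φ^{j,i} on the right.
  sends-rotation⁻¹ : ∀ {γ Φ} i j → Sends γ Φ (Φ ^ i ^ j) → Sends (inverseAut P γ) Φ (Φ ^ j ^ i)
  sends-rotation⁻¹ {γ} {Φ} i j s = sends-resp
    (≃-trans (^-cong i (^-involutive (Φ ^ i) j)) (^-involutive Φ i)) ≃-refl
    (sends-^ i (sends-^ j (sends-inverse s)))

  -- Follow the flag: the first γ takes Φ^i to Φ^{j,i,i} = Φ^j, the second takes this to Φ^{j,i,j},
  -- and η takes that to Φ^{k,j,j,i,j} = Φ^{k,i,j} = Φ^{i,k,j}.
  sends-rotation²-rotation : ∀ {γ η Φ i j k} → suc (toℕ i) ℕ.< toℕ k →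
    Sends γ Φ (Φ ^ j ^ i) → Sends η Φ (Φ ^ k ^ j) →
    Sends (_then_ P (_then_ P γ γ) η) (Φ ^ i) (Φ ^ i ^ k ^ j)
  sends-rotation²-rotation {γ} {η} {Φ} {i} {j} {k} i<k s t =
    (sends-resp ≃-refl (^-involutive (Φ ^ j) i) (sends-^ i s) ⨾ sends-^ j s)
      ⨾ sends-resp ≃-refl
          (^-cong j (≃-trans (^-cong i (^-involutive (Φ ^ k) j)) (≃-sym (^-comm Φ i<k))))
          (sends-^ j (sends-^ i (sends-^ j t)))

  sends-far-rotation : ∀ {γ Φ i j k} → suc (toℕ i) ℕ.< toℕ j → suc (toℕ i) ℕ.< toℕ k →
    Sends γ Φ (Φ ^ k ^ j) → Sends γ (Φ ^ i) (Φ ^ i ^ k ^ j)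
  sends-far-rotation {Φ = Φ} {i} {j} {k} i<j i<k s = sends-resp ≃-refl
    (≃-trans (≃-sym (^-comm (Φ ^ k) i<j)) (^-cong j (≃-sym (^-comm Φ i<k))))
    (sends-^ i s)

  -- The preimages of Ψ under both automorphisms are Φ. This agreement spreads along adjacent flags
  -- to one through `to γ F`, which therefore contains `to η F`; the two faces have equal rank.
  rigid : ∀ {γ η Φ Ψ} → Sends γ Φ Ψ → Sends η Φ Ψ → ∀ F → to γ F ≡ to η F
  rigid {γ} {η} {Φ} {Ψ} s t F =
    let Θ , γF∈Θ = flag-through (to γ F)
        Θ′ , path , Θ′≋Θ = strongly-flag-connected Ψ Θ
        agree = along Ψ Θ Ψ path (mk≃ λ G → trans (sym (maps s G)) (maps t G))
        ηF∈Θ = subst T (trans (sym (Θ′≋Θ (to γ F))) (trans (same agree F) (Θ′≋Θ (to η F)))) γF∈Θ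
    in unique-face Θ γF∈Θ ηF∈Θ (trans (rank-invariant γ F) (sym (rank-invariant η F)))
    where
    along : ∀ A B Θ {Θ′} → Star (Step rank A B) Θ Θ′ →
            preimage γ Θ ≃ preimage η Θ → preimage γ Θ′ ≃ preimage η Θ′
    along _ _ _ done eq = eq
    along A B Θ (_◅_ {j = Θ₁} ((r , adj) , _) path) eq = along A B Θ₁ path
      (adjacent-unique r eq (preimage-adjacent γ Θ Θ₁ adj) (preimage-adjacent η Θ Θ₁ adj))

-- Comparing values of words in two groups.

eval-related : ∀ {k l} (G : MarkedGroup l) (H : MarkedGroup k) (f : Fin k → Term (Fin l)) →
  let module G = MarkedGroup G ; module H = MarkedGroup H in
  (R : G.Carrier → H.Carrier → Set) →
  R G.ε H.ε →
  (∀ {x y x′ y′} → R x x′ → R y y′ → R (x G.∙ y) (x′ H.∙ y′)) →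
  (∀ {x x′} → R x x′ → R (x G.⁻¹) (x′ H.⁻¹)) →
  (∀ i → R (G.eval (f i)) (H.gen i)) →
  ∀ t → R (G.eval (t >>= f)) (H.eval t)
eval-related G H f R R-ε R-∙ R-⁻¹ R-gen = go
  where
  go : ∀ t → R (MarkedGroup.eval G (t >>= f)) (MarkedGroup.eval H t)
  go (var i) = R-gen i
  go 𝟙       = R-ε
  go (s · t) = R-∙ (go s) (go t)
  go (inv t) = R-⁻¹ (go t)

module _ {c ℓ} (G : Group c ℓ) where
  open Group G using (Carrier; setoid; _≈_; _∙_; ε; _⁻¹; assoc; identityˡ; identityʳ; ∙-congˡ; ∙-congʳ)
  open GroupProperties G
  open import Relation.Binary.Reasoning.Setoid setoid

  module _ (γ : Carrier) where
    intertwine-ε : γ ∙ ε ≈ ε ∙ γ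
    intertwine-ε = Group.trans G (identityʳ γ) (Group.sym G (identityˡ γ))

    intertwine-∙ : ∀ {x y x′ y′} → γ ∙ x′ ≈ x ∙ γ → γ ∙ y′ ≈ y ∙ γ → γ ∙ (x′ ∙ y′) ≈ (x ∙ y) ∙ γ
    intertwine-∙ {x} {y} {x′} {y′} p q = begin
      γ ∙ (x′ ∙ y′) ≈⟨ assoc γ x′ y′ ⟨
      γ ∙ x′ ∙ y′   ≈⟨ ∙-congʳ p ⟩
      x ∙ γ ∙ y′    ≈⟨ assoc x γ y′ ⟩
      x ∙ (γ ∙ y′)  ≈⟨ ∙-congˡ q ⟩
      x ∙ (y ∙ γ)   ≈⟨ assoc x y γ ⟨
      x ∙ y ∙ γ     ∎

    intertwine-⁻¹ : ∀ {x x′} → γ ∙ x′ ≈ x ∙ γ → γ ∙ x′ ⁻¹ ≈ x ⁻¹ ∙ γ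
    intertwine-⁻¹ {x} {x′} p = ∙-cancelˡ x (γ ∙ x′ ⁻¹) (x ⁻¹ ∙ γ) (begin
      x ∙ (γ ∙ x′ ⁻¹)  ≈⟨ assoc x γ (x′ ⁻¹) ⟨
      x ∙ γ ∙ x′ ⁻¹    ≈⟨ ∙-congʳ p ⟨
      γ ∙ x′ ∙ x′ ⁻¹   ≈⟨ //-rightDividesʳ x′ γ ⟩
      γ                ≈⟨ \\-leftDividesˡ x γ ⟨
      x ∙ (x ⁻¹ ∙ γ)   ∎)

-- Rotations and the change of base flag to Φ⁰.

marked : ∀ {n} (P : Polytope n) → (Fin (n ℕ.∸ 1) → Automorphism P) → MarkedGroup (n ℕ.∸ 1)
marked P g = record { group = Γ P ; gen = g }

module Rotations {n} (P : Polytope n) (finite : Finite P) where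
  open Flags P finite

  -- The rotations are characterised rather than referred to as σ, whose unfolding
  -- through adjacentFlag is too large to compute with.
  RotationsAt : Flag (Polytope._≤_ P) → (Fin (n ℕ.∸ 1) → Automorphism P) → Set
  RotationsAt Φ g = ∀ i → Sends (g i) Φ (Φ ^ upper i ^ lower i)

module _ {m} (P : Polytope (suc m)) (finite : Finite P) where
  open Flags P finite
  open Rotations P finite

  module _ {Φ g} (g-sends : RotationsAt Φ g) where
    private module G = MarkedGroup (marked P g)

    -- This explains the formula for `bar`: σ₁⁻¹, σ₁²σ₂ and σⱼ for j ≥ 3 are the rotations based at
    -- Φ⁰.
    barGen-sends : ∀ i → Sends (G.eval (barGen i)) (Φ ^ zero) (Φ ^ zero ^ upper i ^ lower i)
    barGen-sends zero = sends-^ zero (sends-rotation⁻¹ (suc zero) zero (g-sends zero))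
    barGen-sends (suc zero) =
      sends-rotation²-rotation (ℕ.s≤s (ℕ.s≤s ℕ.z≤n)) (g-sends zero) (g-sends (suc zero))
    barGen-sends i@(suc (suc _)) =
      sends-far-rotation (ℕ.s≤s (ℕ.s≤s ℕ.z≤n)) (ℕ.s≤s (ℕ.s≤s ℕ.z≤n)) (g-sends i)

    -- Conjugation by γ carries the rotations at Φ⁰ to those at Ψ.
    bar-relator : ∀ {Ψ h γ} → RotationsAt Ψ h → Sends γ (Φ ^ zero) Ψ →
      ∀ t → G.Relator (bar t) → MarkedGroup.Relator (marked P h) t
    bar-relator {Ψ} {h} {γ} h-sends s t bart≈ε = ∙-cancelˡ γ (H.eval t) H.ε (begin
        γ G.∙ H.eval t         ≈⟨ conjugate t ⟩
        G.eval (bar t) G.∙ γ   ≈⟨ G.∙-congʳ {γ} {G.eval (bar t)} {G.ε} bart≈ε ⟩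
        G.ε G.∙ γ              ≈⟨ intertwine-ε G.group γ ⟨
        γ G.∙ G.ε              ∎)
      where
      module H = MarkedGroup (marked P h)
      open GroupProperties G.group using (∙-cancelˡ)
      open import Relation.Binary.Reasoning.Setoid G.setoid
      conjugate : ∀ t → γ G.∙ H.eval t G.≈ G.eval (bar t) G.∙ γ
      conjugate = eval-related (marked P g) (marked P h) barGen (λ x y → γ G.∙ y G.≈ x G.∙ γ)
        (intertwine-ε G.group γ)
        (λ {x} {y} {x′} {y′} → intertwine-∙ G.group γ {x} {y} {x′} {y′})
        (λ {x} {x′} → intertwine-⁻¹ G.group γ {x} {x′})
        -- Both products send Φ⁰ to Ψ ^ `upper i` ^ `lower i`: one moves to Ψ and rotates there, the
        -- other rotates at Φ⁰ first.
        λ i → rigid (s ⨾ h-sends i)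
                    (barGen-sends i ⨾ sends-^ (lower i) (sends-^ (upper i) s))

-- Rotations of the dual.

opposite-inject₁ : ∀ {m} (i : Fin m) → opposite (inject₁ i) ≡ suc (opposite i)
opposite-inject₁ zero    = refl
opposite-inject₁ (suc i) = cong inject₁ (opposite-inject₁ i)

opposite-upper : ∀ {n} (i : Fin (n ℕ.∸ 1)) → opposite (upper {n} (opposite i)) ≡ lower i
opposite-upper {suc n} i = cong inject₁ (Finₚ.opposite-involutive i)

opposite-lower : ∀ {n} (i : Fin (n ℕ.∸ 1)) → opposite (lower {n} (opposite i)) ≡ upper i
opposite-lower {suc n} i = trans (opposite-inject₁ (opposite i)) (cong suc (Finₚ.opposite-involutive i))

-- The automorphism δ of W⁺: index i stands for σ with number i + 1, and `opposite i` for number n -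
-- (i + 1).
δGen : ∀ {m} → Fin m → Term (Fin m)
δGen i = inv (var (opposite i))

module _ {n} (P : Polytope n) (finite : Finite P) where
  open Flags P finite
  open Rotations P finite
  private
    P* = dualPolytope P
    module Dual = Flags P* finite

  opposite-proper : ∀ j → opposite (proper P j) ≡ proper P (opposite j)
  opposite-proper j = cong inject₁ (opposite-inject₁ j)

  dual-^ : ∀ Φ j → dualFlag (Φ Dual.^ j) ≃ dualFlag Φ ^ opposite j
  dual-^ Φ j = ≃-sym (^-unique (opposite j)
    (proj₁ (Dual.^-adjacent Φ j) , λ F r≢ → proj₂ (Dual.^-adjacent Φ j) F λ eq →
      r≢ (trans (sym (Finₚ.opposite-involutive (Polytope.rank P F)))
           (trans (cong opposite eq) (opposite-proper j)))))

  -- Yields the identification of Γ⁺ of the dual with W/δ(M). Both groups act on the same faces, so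
  -- values are compared as maps, and rigidity settles the generators.
  δ-eval : ∀ {Φ g h} → RotationsAt Φ g → Rotations.RotationsAt P* finite (dualFlag Φ) h → ∀ t F →
    Automorphism.to (MarkedGroup.eval (marked P* h) (t >>= δGen)) F ≡
    Automorphism.to (MarkedGroup.eval (marked P g) t) F
  δ-eval {Φ} {g} {h} g-sends h-sends = eval-related (marked P* h) (marked P g) δGen
    (λ x y → ∀ F → Automorphism.to x F ≡ Automorphism.to y F)
    (λ _ → refl)
    (λ {_} {y} {x′} p q F → trans (cong (Automorphism.to y) (p F)) (q (Automorphism.to x′ F)))
    (λ {x} {x′} p → Group.⁻¹-cong (Γ P) {undualAutomorphism P x} {x′} p)
    λ i → rigid (undual i) (g-sends i)
    where
    undual : ∀ i → Sends (undualAutomorphism P (inverseAut P* (h (opposite i)))) Φ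
                         (Φ ^ upper i ^ lower i)
    -- In the dual the inverse rotation performs the exchanges `l`, then `u`; reversing ranks turns
    -- these into `upper i`, then `lower i`.
    undual i = sends-resp ≃-refl
      (≃-trans (dual-^ (dualFlag Φ Dual.^ l) u)
        (≃-trans (^-cong (opposite u) (≃-trans (dual-^ (dualFlag Φ) l)
                   (^-cong (opposite l) (mk≃ λ _ → refl))))
          (subst₂ (λ v k → Φ ^ opposite l ^ opposite u ≃ Φ ^ v ^ k)
            (opposite-lower i) (opposite-upper i) ≃-refl)))
      (mkSends (Dual.maps (Dual.sends-rotation⁻¹ u l (h-sends (opposite i)))))
      where
      u = upper (opposite i)
      l = lower (opposite i)

-- Relators of the mirror image and of its dual.

σ-rotations : ∀ {n} (P : ChiralPolytope n) finite →
              Rotations.RotationsAt (polytope P) finite (base P) (σ P)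
σ-rotations P finite i = sends-resp ≃-refl
  (adjacentFlag≃^ (lower i) (adjacentFlag≃^ (upper i) ≃-refl)) (mkSends (proj₂ (rotation P i)))
  where open Flags (polytope P) finite

mirror-finite : ∀ {n} (P : ChiralPolytope n) → Finite (polytope P) → Finite (polytope (mirror P))
mirror-finite {zero}  P finite = finite
mirror-finite {suc n} P finite = finite

bar-relator-mirror : ∀ {m} (P : ChiralPolytope (suc m)) → Finite (polytope P) → ∀ t →
  MarkedGroup.Relator (Γ⁺ P) (bar t) → MarkedGroup.Relator (Γ⁺ (mirror P)) t
bar-relator-mirror P finite = bar-relator (polytope P) finite
  (σ-rotations P finite) (σ-rotations (mirror P) finite)
  -- The mirror image has the same faces and is based at Φ⁰, so the conjugating automorphism is the
  -- identity.
  (mkSends {γ = idAut (polytope P)} (same (≃-sym (adjacentFlag≃^ zero (≃-refl {base P})))))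
  where open Flags (polytope P) finite

-- The base flags Φⁿ⁻¹ of the mirrored dual and Φ⁰ of the dualised mirror are
-- both adjacent to Φ, so they lie in one orbit.
bar-relator-dual-mirror : ∀ {m} (P : ChiralPolytope (suc m)) → Finite (polytope P) → ∀ t →
  MarkedGroup.Relator (Γ⁺ (dual P)) (bar t) → MarkedGroup.Relator (Γ⁺ (dual (mirror P))) t
bar-relator-dual-mirror P finite =
  let γ , γ-maps = SameOrbit-adjacent² P* (isChiral (dual P)) (Φ* ^ zero) Φ* (base (dual (mirror P)))
                     (_ , AdjacentAt-sym Φ* (Φ* ^ zero) (^-adjacent Φ* zero))
                     (_ , ne , λ F r≢ → eq F (r≢ ∘ cong opposite))
  in bar-relator P* finite (σ-rotations (dual P) finite) (σ-rotations (dual (mirror P)) finite)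
       (mkSends {γ = γ} γ-maps)
  where
  P* = polytope (dual P)
  Φ* = base (dual P)
  open Flags P* finite
  Φ⁰ = adjacentFlag (polytope P) (base P) zero
  ne = proj₁ (proj₂ Φ⁰)
  eq = proj₂ (proj₂ Φ⁰)

-- The step from invariance of N to N = A ∩ B: a word whose `bar` lies in M and δ(M) lies in the
-- kernels belonging to the mirror image and its dual.
mirror-relators : ∀ {n} (P : ChiralPolytope n) → Finite (polytope P) → ∀ t →
  let module G = MarkedGroup (Γ⁺ P) ; module H = MarkedGroup (Γ⁺ (dual P)) in
  G.Relator t × H.Relator t → G.Relator (bar t) × H.Relator (bar t) →
  MarkedGroup.Relator (Γ⁺ (mirror P)) t × MarkedGroup.Relator (Γ⁺ (dual (mirror P))) t
-- In rank 0 `mirror` is the identity, so the relators of `t` itself are the ones wanted.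
mirror-relators {zero}  P finite t p _ = p
mirror-relators {suc n} P finite t _ (p , q) =
  bar-relator-mirror P finite t p , bar-relator-dual-mirror P finite t q

-- Counting with the comix.

HasOrder-injective : ∀ {G m} (order : HasOrder G m) → ∀ {x y} →
  Inverse.to order x ≡ Inverse.to order y → Group._≈_ G x y
HasOrder-injective {G} order {x} {y} eq = Group.trans G
  (Group.sym G (Inverse.strictlyInverseʳ order x)) (Inverse.inverseʳ order eq)

module _ {k} (A B : MarkedGroup k) where
  private
    module A = MarkedGroup A
    module B = MarkedGroup B
    module Aₚ = GroupProperties A.group
    module Bₚ = GroupProperties B.group

  -- Identifies the two copies of each generator, as the `glue` relators do.
  collapse : Term (Fin k ⊎ Fin k) → Term (Fin k)
  collapse t = t >>= [ var , var ]′

  collapse-inj₁ : ∀ t → collapse (t >>= (var ∘ inj₁)) ≡ t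
  collapse-inj₁ (var i) = refl
  collapse-inj₁ 𝟙       = refl
  collapse-inj₁ (s · t) = cong₂ _·_ (collapse-inj₁ s) (collapse-inj₁ t)
  collapse-inj₁ (inv t) = cong inv (collapse-inj₁ t)

  collapse-inj₂ : ∀ t → collapse (t >>= (var ∘ inj₂)) ≡ t
  collapse-inj₂ (var i) = refl
  collapse-inj₂ 𝟙       = refl
  collapse-inj₂ (s · t) = cong₂ _·_ (collapse-inj₂ s) (collapse-inj₂ t)
  collapse-inj₂ (inv t) = cong inv (collapse-inj₂ t)

  -- If A = W/K and B = W/L, then A □ B = W/KL, so words equal in the comix
  -- have cosets of K and of L that meet.
  Meet : Term (Fin k ⊎ Fin k) → Term (Fin k ⊎ Fin k) → Set
  Meet s t = ∃ λ w → A.eval w A.≈ A.eval (collapse s) × B.eval w B.≈ B.eval (collapse t)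

  -- Induction on the derivation. A relator of `A` admits `𝟙` as common word, a relator `t` of `B`
  -- admits `t` itself, and group laws hold on both sides.
  comix-meet : ∀ {s t} → ComixRelator A B ⊢ s ≈ t → Meet s t
  comix-meet (≈-rel (left t r)) rewrite collapse-inj₁ t = 𝟙 , A.sym r , B.refl
  comix-meet (≈-rel (right t r)) rewrite collapse-inj₂ t = t , A.refl , r
  comix-meet (≈-rel (glue i)) = 𝟙 , A.sym (A.inverseˡ (A.gen i)) , B.refl
  comix-meet {s} ≈-refl = collapse s , A.refl , B.refl
  comix-meet (≈-sym {s} {t} p) =
    let w , wA , wB = comix-meet p in
    -- `w` has the value of s in `A` and of t in `B`, so t w⁻¹ s has the value of t in `A` and of s
    -- in `B`.
    (collapse t · inv w) · collapse s ,
    A.trans (A.∙-congʳ (A.∙-congˡ (A.⁻¹-cong wA))) (Aₚ.//-rightDividesˡ _ _) ,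
    B.trans (B.∙-congʳ (B.trans (B.∙-congˡ (B.⁻¹-cong wB)) (B.inverseʳ _))) (B.identityˡ _)
  comix-meet (≈-trans {s} {t} {u} p q) =
    let w , wA , wB = comix-meet p
        v , vA , vB = comix-meet q in
    -- The middle word cancels against `v` in `A` and against `w` in `B`.
    (w · inv (collapse t)) · v ,
    A.trans (A.∙-cong (A.∙-congʳ wA) vA) (Aₚ.//-rightDividesˡ _ _) ,
    B.trans (B.∙-congʳ (B.trans (B.∙-congʳ wB) (B.inverseʳ _))) (B.trans (B.identityˡ _) vB)
  comix-meet (·-cong p q) =
    let w , wA , wB = comix-meet p
        v , vA , vB = comix-meet q in
    w · v , A.∙-cong wA vA , B.∙-cong wB vB
  comix-meet (inv-cong p) =
    let w , wA , wB = comix-meet p in inv w , A.⁻¹-cong wA , B.⁻¹-cong wB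
  comix-meet {x} (·-assoc s t u) = collapse x , A.refl , B.assoc _ _ _
  comix-meet {x} (·-identityˡ t) = collapse x , A.refl , B.identityˡ _
  comix-meet {x} (·-identityʳ t) = collapse x , A.refl , B.identityʳ _
  comix-meet {x} (·-inverseˡ t)  = collapse x , A.refl , B.inverseˡ _
  comix-meet {x} (·-inverseʳ t)  = collapse x , A.refl , B.inverseʳ _

  module _ {a b c d} (X : Fin a → Term (Fin k)) (Y : Fin b → Term (Fin k))
    (X-injective : ∀ {i j} → A.eval (X i) A.≈ A.eval (X j) → i ≡ j)
    (Y-injective : ∀ {i j} → B.eval (Y i) B.≈ B.eval (Y j) → i ≡ j)
    (order : HasOrder (A □ B) c)
    (κ : Term (Fin k) → Fin d)
    (κ-separates : ∀ u v → κ u ≡ κ v → A.eval u A.≈ A.eval v × B.eval u B.≈ B.eval v)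
    where
    private
      quotient : Fin a → Fin b → Fin c
      quotient i j = Inverse.to order ((inv (X i) · Y j) >>= (var ∘ inj₁))

      ζ : Fin c → Term (Fin k)
      ζ z = collapse (Inverse.from order z)

      -- That a class equals its chosen representative is a derivation in the comix; the word
      -- extracted from it, multiplied by `X i`, lies in both cosets. The factor `ζ` depends on the
      -- class alone, so it can be cancelled later.
      lift : ∀ i j → ∃ λ w → A.eval w A.≈ A.eval (X i) A.∙ A.eval (ζ (quotient i j)) ×
                             B.eval w B.≈ B.eval (Y j)
      lift i j =
        let w , wA , wB = comix-meet (Inverse.strictlyInverseʳ order ((inv (X i) · Y j) >>= (var ∘ inj₁)))
        in X i · w , A.∙-congˡ wA ,
           B.trans (B.∙-congˡ (subst (λ t → B.eval w B.≈ B.eval t) (collapse-inj₁ (inv (X i) · Y j)) wB))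
                   (Bₚ.\\-leftDividesˡ _ _)

      encode : Fin (a ℕ.* b) → Fin (c ℕ.* d)
      encode p = let i , j = remQuot b p in combine (quotient i j) (κ (proj₁ (lift i j)))

      -- Equal codes give words equal in `A` and in `B`. The value in `B` recovers j; the value in
      -- `A`, after cancelling the common `ζ`, recovers i.
      encode-injective : Injective _≡_ _≡_ encode
      encode-injective {p} {q} eq =
        let i , j = remQuot {a} b p
            i′ , j′ = remQuot {a} b q
            w , wA , wB = lift i j
            w′ , wA′ , wB′ = lift i′ j′
            z≡z′ , κ≡κ′ = Finₚ.combine-injective (quotient i j) (κ w) (quotient i′ j′) (κ w′) eq
            ≈A , ≈B = κ-separates w w′ κ≡κ′
            i≡i′ = X-injective (Aₚ.∙-cancelʳ (A.eval (ζ (quotient i j))) _ _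
              (A.trans (A.sym wA) (A.trans ≈A
                (subst (λ z → A.eval w′ A.≈ A.eval (X i′) A.∙ A.eval (ζ z)) (sym z≡z′) wA′))))
            j≡j′ = Y-injective (B.trans (B.sym wB) (B.trans ≈B wB′))
        in trans (sym (Finₚ.combine-remQuot {a} b p))
             (trans (cong₂ combine i≡i′ j≡j′) (Finₚ.combine-remQuot {a} b q))

    comix-bound : a ℕ.* b ℕ.≤ c ℕ.* d
    comix-bound = Finₚ.injective⇒≤ {f = encode} encode-injective

-- Words and orders in mixes.

eval-⟪⟫ : ∀ {k} (G : MarkedGroup k) t → proj₁ (MarkedGroup.eval ⟪ G ⟫ t) ≡ MarkedGroup.eval G t
eval-⟪⟫ G (var i) = refl
eval-⟪⟫ G 𝟙       = refl
eval-⟪⟫ G (s · t) = cong₂ (MarkedGroup._∙_ G) (eval-⟪⟫ G s) (eval-⟪⟫ G t)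
eval-⟪⟫ G (inv t) = cong (MarkedGroup._⁻¹ G) (eval-⟪⟫ G t)

-- Each element of `⟪ G ⟫` carries a word evaluating to it, so an enumeration of the group is also
-- one of representing words.
⟪⟫-representatives : ∀ {k a} (G : MarkedGroup k) → HasOrder (MarkedGroup.group ⟪ G ⟫) a →
  ∃ λ (X : Fin a → Term (Fin k)) →
  ∀ {i j} → MarkedGroup._≈_ ⟪ G ⟫ (MarkedGroup.eval ⟪ G ⟫ (X i)) (MarkedGroup.eval ⟪ G ⟫ (X j)) → i ≡ j
⟪⟫-representatives G order = X , λ {i} {j} eq →
  trans (sym (Inverse.strictlyInverseˡ order i))
    (trans (Inverse.to-cong order (G.trans (G.sym (X-represents i)) (G.trans eq (X-represents j))))
      (Inverse.strictlyInverseˡ order j))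
  where
  module G = MarkedGroup G
  X = λ i → proj₁ (proj₂ (Inverse.from order i))
  X-represents : ∀ i → proj₁ (MarkedGroup.eval ⟪ G ⟫ (X i)) G.≈ proj₁ (Inverse.from order i)
  X-represents i = subst (G._≈ proj₁ (Inverse.from order i)) (sym (eval-⟪⟫ G (X i)))
    (proj₂ (proj₂ (Inverse.from order i)))

module _ {k} (G H : MarkedGroup k) where
  private
    module G = MarkedGroup G
    module H = MarkedGroup H
    module M = MarkedGroup (G ◇ H)

  eval-◇ : ∀ t → proj₁ (M.eval t) ≡ (G.eval t , H.eval t)
  eval-◇ (var i) = refl
  eval-◇ 𝟙       = refl
  eval-◇ (s · t) = cong₂ (Group._∙_ (DirectProduct.group G.group H.group)) (eval-◇ s) (eval-◇ t)
  eval-◇ (inv t) = cong (Group._⁻¹ (DirectProduct.group G.group H.group)) (eval-◇ t)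

  ◇-≈⁻ : ∀ s t → M.eval s M.≈ M.eval t → G.eval s G.≈ G.eval t × H.eval s H.≈ H.eval t
  ◇-≈⁻ s t = subst₂ (Group._≈_ (DirectProduct.group G.group H.group)) (eval-◇ s) (eval-◇ t)

  ◇-≈⁺ : ∀ s t → G.eval s G.≈ G.eval t × H.eval s H.≈ H.eval t → M.eval s M.≈ M.eval t
  ◇-≈⁺ s t = subst₂ (Group._≈_ (DirectProduct.group G.group H.group)) (sym (eval-◇ s)) (sym (eval-◇ t))

-- Representatives of the first mix are carried by `δ` to words distinct in the second, so both
-- families have size a. A word is recorded by its values in `G` and `H`, at most b b′
-- possibilities.
mix-order-bound : ∀ {k a b b′ c} (G G′ H H′ : MarkedGroup k) →
  let module G = MarkedGroup G ; module G′ = MarkedGroup G′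
      module H = MarkedGroup H ; module H′ = MarkedGroup H′ in
  HasOrder (MarkedGroup.group (G ◇ G′)) a →
  HasOrder G.group b → HasOrder H.group b′ →
  HasOrder ((G ◇ G′) □ (H ◇ H′)) c →
  (δ : Term (Fin k) → Term (Fin k)) →
  (∀ s t → H.eval (δ s) H.≈ H.eval (δ t) → G.eval s G.≈ G.eval t) →
  (∀ s t → H′.eval (δ s) H′.≈ H′.eval (δ t) → G′.eval s G′.≈ G′.eval t) →
  (∀ t → G.Relator t × H.Relator t → G′.Relator t × H′.Relator t) →
  a ℕ.* a ℕ.≤ c ℕ.* (b ℕ.* b′)
mix-order-bound {k} {a} {b} {b′} G G′ H H′ orderA orderG orderH orderC δ δ-reflects δ-reflects′ kernel =
  comix-bound (G ◇ G′) (H ◇ H′) X (δ ∘ X) X-injective δX-injective orderC κ κ-separates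
  where
  module G = MarkedGroup G
  module G′ = MarkedGroup G′
  module H = MarkedGroup H
  module H′ = MarkedGroup H′
  X = proj₁ (⟪⟫-representatives _ orderA)
  X-injective = proj₂ (⟪⟫-representatives _ orderA)

  δX-injective : ∀ {i j} → MarkedGroup._≈_ (H ◇ H′) (MarkedGroup.eval (H ◇ H′) (δ (X i)))
                             (MarkedGroup.eval (H ◇ H′) (δ (X j))) → i ≡ j
  δX-injective {i} {j} eq =
    let p , q = ◇-≈⁻ H H′ (δ (X i)) (δ (X j)) eq
    in X-injective (◇-≈⁺ G G′ (X i) (X j) (δ-reflects _ _ p , δ-reflects′ _ _ q))

  κ : Term (Fin k) → Fin (b ℕ.* b′)
  κ t = combine (Inverse.to orderG (G.eval t)) (Inverse.to orderH (H.eval t))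

  κ-separates : ∀ u v → κ u ≡ κ v →
    MarkedGroup._≈_ (G ◇ G′) (MarkedGroup.eval (G ◇ G′) u) (MarkedGroup.eval (G ◇ G′) v) ×
    MarkedGroup._≈_ (H ◇ H′) (MarkedGroup.eval (H ◇ H′) u) (MarkedGroup.eval (H ◇ H′) v)
  κ-separates u v eq =
    let p , q = Finₚ.combine-injective (Inverse.to orderG (G.eval u)) (Inverse.to orderH (H.eval u))
                  (Inverse.to orderG (G.eval v)) (Inverse.to orderH (H.eval v)) eq
        u≈v  = HasOrder-injective {G.group} orderG p
        u≈v* = HasOrder-injective {H.group} orderH q
        -- Words equal in `G` and `H` differ by an element of N, which `kernel` places in the
        -- kernels of `G′` and `H′` too.
        p′ , q′ = kernel (u · inv v)
          (GroupProperties.x≈y⇒x∙y⁻¹≈ε G.group u≈v , GroupProperties.x≈y⇒x∙y⁻¹≈ε H.group u≈v*)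
    in ◇-≈⁺ G G′ u v (u≈v , GroupProperties.x∙y⁻¹≈ε⇒x≈y G′.group _ _ p′) ,
       ◇-≈⁺ H H′ u v (u≈v* , GroupProperties.x∙y⁻¹≈ε⇒x≈y H′.group _ _ q′)

-- The numerical contradiction.

dual-order : ∀ {n} (P : Polytope n) {b} → HasOrder (Γ P) b → HasOrder (Γ (dualPolytope P)) b
dual-order P order = record
  { to        = to ∘ undualAutomorphism P
  ; from      = dualAutomorphism P ∘ from
  ; to-cong   = to-cong
  ; from-cong = from-cong
  ; inverse   = inverseˡ , inverseʳ
  }
  where open Inverse order

-- Cross-multiplication: in unnormalised rationals the square of a / b has numerator a² and
-- denominator b², which appears once `b` is matched as a successor.
square-bound : ∀ a b c .{{_ : NonZero b}} → (+ a / b) * (+ a / b) > + c / 1 →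
               c ℕ.* (b ℕ.* b) ℕ.< a ℕ.* a
square-bound a b@(suc _) c (*<* lt) = ℤₚ.drop‿+<+ (subst₂ ℤ._<_
  (sym (ℤₚ.pos-* c (b ℕ.* b)))
  (trans (ℤₚ.*-identityʳ (+ a ℤ.* + a)) (sym (ℤₚ.pos-* a a)))
  lt)

δ-reflects : ∀ {n} (P : ChiralPolytope n) → Finite (polytope P) → ∀ s t →
  let module G = MarkedGroup (Γ⁺ P) ; module H = MarkedGroup (Γ⁺ (dual P)) in
  H.eval (s >>= δGen) H.≈ H.eval (t >>= δGen) → G.eval s G.≈ G.eval t
δ-reflects P finite s t eq F = trans (sym (δ-σ s F)) (trans (eq F) (δ-σ t F))
  where
  δ-σ = δ-eval (polytope P) finite (σ-rotations P finite) (σ-rotations (dual P) finite)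

theorem5p4 : ∀ {n} (P : ChiralPolytope n) → Finite (polytope P) →
    ∀ (a b c : ℕ) .{{_ : NonZero b}} →
    HasOrder (MarkedGroup.group (Γ⁺ P ◇ Γ⁺ (mirror P))) a →
    HasOrder (MarkedGroup.group (Γ⁺ P)) b →
    HasOrder ((Γ⁺ P ◇ Γ⁺ (mirror P)) □ (Γ⁺ (dual P) ◇ Γ⁺ (dual (mirror P)))) c →
    (+ a / b) * (+ a / b) > + c / 1 →
    MixIsChiral P (dual P)
theorem5p4 P finite a b c orderA orderG orderC a²/b²>c (bar-invariant , _) =
  contradiction (square-bound a b c a²/b²>c) (ℕₚ.≤⇒≯ bound)
  where
  bound : a ℕ.* a ℕ.≤ c ℕ.* (b ℕ.* b)
  bound = mix-order-bound (Γ⁺ P) (Γ⁺ (mirror P)) (Γ⁺ (dual P)) (Γ⁺ (dual (mirror P)))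
    orderA orderG (dual-order (polytope P) orderG) orderC (_>>= δGen)
    (δ-reflects P finite) (δ-reflects (mirror P) (mirror-finite P finite))
    -- For `t` in N the word `bar t` lies in `Bar n N`, hence in N by the assumed invariance;
    -- membership is read as equality with `𝟙` in the mix.
    λ t t∈N → mirror-relators P finite t t∈N
      (◇-≈⁻ (Γ⁺ P) (Γ⁺ (dual P)) (bar t) 𝟙
        (bar-invariant (t , ◇-≈⁺ (Γ⁺ P) (Γ⁺ (dual P)) t 𝟙 t∈N , ≈-refl)))
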